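{- For every 3-edge-connected cubic graph $G$, the following holds: 1. If $C\subseteq G$ is a peripheral cycle, there exists a peripheral 2-base $B\subseteq E(G)$ with $E(C)\subseteq B$. 2. For every $r\in V(G)$, the graph $G-r$ has at least three peripheral 2-bases.
   Context: Graphs may have loops and parallel edges. A graph is $k$-edge-connected if it remains connected after deleting any set of fewer than $k$ edges. A graph is cubic if all degrees equal 3, and subcubic if all degrees are at most 3. $G-r$ is obtained by deleting the vertex $r$ and its incident edges; $G-S$ for $S\subseteq E(G)$ is obtained by deleting the edges of $S$ while keeping all vertices. In a subcubic graph $G=(V,E)$, an edge-set $S\subseteq E$ is peripheral if $G-S$ is connected; a subgraph $H\subseteq G$ is peripheral if $E(H)$ is peripheral. For a graph $G=(V,E)$, a positive integer $k$ and $S\subseteq E$, the $k$-closure $\langle S\rangle_k$ is the minimal edge-set $R$ with $S\subseteq R\subseteq E$ such that every cycle $C\subseteq G$ with $E(C)\setminus R\neq\emptyset$ has at least $k+1$ edges that are not in $R$. A set $S\subseteq E$ is a $k$-base of $G$ if $\langle S\rangle_k=E$. A peripheral 2-base of a graph is an edge-set of that graph which is both peripheral and a 2-base in it.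
   Formalization: In part 2 the three peripheral 2-bases are asserted to be distinct only if G has more than two vertices; this excludes just the graph with two vertices and three parallel edges, where G−r has no edges and the empty set is its only peripheral 2-base. -}

module Defs where

open import Data.Bool.Base using (not; _∨_)
open import Data.Fin.Base using (Fin; zero; suc; inject₁; fromℕ)
open import Data.Fin.Properties using (_≟_)
open import Data.Fin.Subset using (Subset; _∈_; _⊆_; _∩_; _─_; _-_; ∣_∣; Nonempty)
open import Data.Fin.Subset.Properties
  using (p─q⊆p; p∩q⊆p; p∩q⊆q; x∈p∧x≢y⇒x∈p-y)
open import Data.Nat.Base using (ℕ; suc; _+_; _<_; _≤_)
open import Data.Product.Base using (∃; _×_; _,_; proj₁; proj₂)
open import Data.Sum.Base using (_⊎_)
open import Data.Vec.Base using (tabulate)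
open import Data.Vec.Properties using ([]=⇒lookup; lookup∘tabulate)
open import Function.Bundles using (_⇔_)
open import Function.Definitions using (Injective)
open import Relation.Binary.Construct.Closure.ReflexiveTransitive using (Star)
open import Relation.Binary.PropositionalEquality using (_≡_; _≢_; refl; sym; trans)
open import Relation.Nullary using (yes; no; does)

-- The two ends of every potential edge, in an arbitrary order.
-- Loops (equal ends) and parallel edges are allowed.
Ends : ℕ → ℕ → Set
Ends n m = Fin m → Fin n × Fin n

private
  variable
    n m : ℕ
    ends : Ends n m

-- Vertices and edges are drawn from the ambient sets Fin n and Fin m, so that
-- a graph, its subgraphs and the results of deletions share their labels; the
-- elements outside V and E play no role.
record Graph (ends : Ends n m) : Set where
  field
    V : Subset n
    E : Subset m
    ends∈V : ∀ {e} → e ∈ E → proj₁ (ends e) ∈ V × proj₂ (ends e) ∈ V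

open Graph public

infix 4 _⊆ᴳ_

_⊆ᴳ_ : Graph ends → Graph ends → Set
H ⊆ᴳ G = V H ⊆ V G × E H ⊆ E G

Joins : Ends n m → Fin m → Fin n → Fin n → Set
Joins ends e u v = ends e ≡ (u , v) ⊎ ends e ≡ (v , u)

Adjacent : Graph {n} ends → Fin n → Fin n → Set
Adjacent {ends = ends} G u v = ∃ λ e → e ∈ E G × Joins ends e u v

Connected : Graph ends → Set
Connected G = ∀ {u v} → u ∈ V G → v ∈ V G → Star (Adjacent G) u v

-- A loop contributes 2.
degree : Graph {n} ends → Fin n → ℕ
degree {ends = ends} G v =
    ∣ E G ∩ tabulate (λ e → does (proj₁ (ends e) ≟ v)) ∣
  + ∣ E G ∩ tabulate (λ e → does (proj₂ (ends e) ≟ v)) ∣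

Cubic : Graph ends → Set
Cubic G = ∀ {v} → v ∈ V G → degree G v ≡ 3

nonIncident : Ends n m → Fin n → Subset m
nonIncident ends r =
  tabulate λ e → not (does (proj₁ (ends e) ≟ r) ∨ does (proj₂ (ends e) ≟ r))

nonIncident⇒≢ : ∀ (ends : Ends n m) {r e} → e ∈ nonIncident ends r →
                proj₁ (ends e) ≢ r × proj₂ (ends e) ≢ r
nonIncident⇒≢ ends {r} {e} e∈
  with trans (sym (lookup∘tabulate _ e)) ([]=⇒lookup e∈)
... | eq with proj₁ (ends e) ≟ r | proj₂ (ends e) ≟ r
...   | no ≢₁ | no ≢₂ = ≢₁ , ≢₂
nonIncident⇒≢ ends e∈ | () | no _  | yes _
nonIncident⇒≢ ends e∈ | () | yes _ | _

deleteEdges : Graph {n} {m} ends → Subset m → Graph ends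
deleteEdges G S = record
  { V = V G
  ; E = E G ─ S
  ; ends∈V = λ e∈ → ends∈V G (p─q⊆p (E G) S e∈)
  }

deleteVertex : Graph {n} ends → Fin n → Graph ends
deleteVertex {ends = ends} G r = record
  { V = V G - r
  ; E = E G ∩ nonIncident ends r
  ; ends∈V = λ e∈ →
      let u∈ , v∈ = ends∈V G (p∩q⊆p (E G) (nonIncident ends r) e∈)
          u≢ , v≢ = nonIncident⇒≢ ends (p∩q⊆q (E G) (nonIncident ends r) e∈)
      in  x∈p∧x≢y⇒x∈p-y u∈ u≢ , x∈p∧x≢y⇒x∈p-y v∈ v≢
  }

EdgeConnected : ℕ → Graph ends → Set
EdgeConnected k G = ∀ S → S ⊆ E G → ∣ S ∣ < k → Connected (deleteEdges G S)

-- A graph is a cycle if it consists of distinct vertices v₀, …, vₗ and distinct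
-- edges e₀, …, eₗ, with eᵢ joining vᵢ to vᵢ₊₁ and eₗ joining vₗ to v₀.  Length 1
-- (a loop) and length 2 (two parallel edges) are included.
record IsCycle {ends : Ends n m} (C : Graph ends) : Set where
  field
    ℓ       : ℕ
    vertex  : Fin (suc ℓ) → Fin n
    edge    : Fin (suc ℓ) → Fin m
    vertex-injective : Injective _≡_ _≡_ vertex
    edge-injective   : Injective _≡_ _≡_ edge
    joins   : ∀ (i : Fin ℓ) →
              Joins ends (edge (inject₁ i)) (vertex (inject₁ i)) (vertex (suc i))
    closes  : Joins ends (edge (fromℕ ℓ)) (vertex (fromℕ ℓ)) (vertex zero)
    V-range : ∀ v → v ∈ V C ⇔ ∃ λ i → vertex i ≡ v
    E-range : ∀ e → e ∈ E C ⇔ ∃ λ i → edge i ≡ e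

Peripheral : (G : Graph {n} {m} ends) → Subset m → Set
Peripheral G S = S ⊆ E G × Connected (deleteEdges G S)

record KClosedOver (G : Graph {n} {m} ends) (k : ℕ) (S R : Subset m) : Set where
  field
    S⊆R    : S ⊆ R
    R⊆E    : R ⊆ E G
    cycles : ∀ C → C ⊆ᴳ G → IsCycle C →
             Nonempty (E C ─ R) → k + 1 ≤ ∣ E C ─ R ∣

-- R = ⟨S⟩ₖ, the inclusion-minimal such set.  It is unique, since these sets are
-- stable under intersection.
record IsClosure (G : Graph {n} {m} ends) (k : ℕ) (S R : Subset m) : Set where
  field
    closed  : KClosedOver G k S R
    minimal : ∀ R′ → KClosedOver G k S R′ → R′ ⊆ R → R′ ≡ R

IsBase : ℕ → (G : Graph {n} {m} ends) → Subset m → Set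
IsBase k G S = S ⊆ E G × IsClosure G k S (E G)

PeripheralBase : ℕ → (G : Graph {n} {m} ends) → Subset m → Set
PeripheralBase k G B = Peripheral G B × IsBase k G B

{-# OPTIONS --safe #-}
module Submission where

-- Fix an edge c joining z to x and grow a set X ∌ z, with connected complement Y, until
-- Y = {z}.  In each step choose W ⊆ Y ∖ {z} such that W and K = Y ∖ W are connected and
-- at least two edges join W to X, with W minimal.  If w ∈ W has a neighbour in K, each
-- component of W - w has by minimality at most one edge to X; together with
-- 3-edge-connectivity this forces every vertex of W to have a neighbour in K.  Hence the
-- edges inside W can be put into B: G - B stays connected through K, and the closure of
-- B absorbs W through two of its edges to X.  For a peripheral cycle C one starts with
-- X = V(C) and B = E(C).  In G - r one starts with X = {r}, where c is an edge at r, so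
-- that the first W contains the other two neighbours a and b of r.  These have degree 2
-- in G - r, with exactly one edge in B each; exchanging this edge for the other one
-- at a, or at b, gives two further bases.

-- Both parts run the same growth in a graph `H`, which is `G` or G - r, while degrees and cuts are
-- always counted in `G`. The edge `c` is the one boundary edge that `H` may lack: in G - r it joins
-- `z` to the deleted vertex. Keeping `z` out of every ear means that `c` is never one of the edges
-- through which an ear is absorbed, and at the end `z` still has two further edges. The edge `c`
-- also limits `z` to two edges into `Y`, which produces an ear to start from. The number two in the
-- definition of an ear matches the 2-closure: a closed set absorbs an edge as soon as some cycle
-- through it has at most two edges outside. In G - r no vertex lies outside `Y` at the start, so
-- the first ear is not absorbed but spanned by its own edges. The exchange works because two edges
-- at a vertex of degree 2 are in series. For two vertices joined by three parallel edges, G - r has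
-- only the empty base; hence distinctness is claimed for more than two vertices.

open import Defs
open import Algebra.Properties.CommutativeMonoid.Sum using (sum; sum-cong-≗; ∑-distrib-+)
open import Data.Bool.Base using (Bool; true; false; not; _∧_; _∨_; if_then_else_)
open import Data.Bool.Properties using (¬-not)
open import Data.Empty using (⊥; ⊥-elim)
open import Data.Fin.Base using (Fin; zero; suc; inject₁; fromℕ; toℕ)
open import Data.Fin.Induction using (<-weakInduction)
open import Data.Fin.Properties using (_≟_; any?; toℕ-inject₁)
open import Data.Fin.Relation.Unary.Top using (view; ‵fromℕ; ‵inject₁)
open import Data.Fin.Subset using (Subset; _∈_; _∉_; _⊆_; _∩_; _∪_; _─_; _-_; ∣_∣; ⁅_⁆) renaming (⊥ to ∅)
open import Data.Fin.Subset.Properties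
open import Data.List.Base using (List; []; _∷_; map; length)
open import Data.List.Relation.Unary.All using (All; []; _∷_)
open import Data.List.Relation.Unary.AllPairs using ([]; _∷_)
open import Data.List.Relation.Unary.Unique.Propositional using (Unique)
open import Data.Nat.Base using (ℕ; zero; suc; _+_; _*_; _≤_; _<_; z≤n; s≤s)
open import Data.Nat.ListAction using () renaming (sum to sumᴸ)
open import Data.Nat.Properties hiding (_≟_)
open import Data.Nat.Solver using (module +-*-Solver)
open import Data.Product.Base using (Σ; ∃; ∃-syntax; _×_; _,_; proj₁; proj₂)
open import Data.Product.Properties using (≡-dec)
open import Data.Sum.Base using (_⊎_; inj₁; inj₂; [_,_]′; swap)
open import Data.Vec.Base using ([]; _∷_; tabulate; lookup; there)
open import Data.Vec.Properties using ([]=⇒lookup; lookup⇒[]=; lookup∘tabulate; lookup-zipWith)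
open import Function.Base using (_∘_; id)
open import Function.Bundles using (mk⇔; module Equivalence)
open import Function.Definitions using (Injective)
open import Relation.Binary.Construct.Closure.ReflexiveTransitive as Star using (Star; ε; _◅_; _◅◅_)
open import Relation.Binary.PropositionalEquality hiding (J)
open import Relation.Nullary using (¬_; Dec; yes; no; does; contradiction)
open import Relation.Nullary.Decidable using (dec-true; dec-false; ¬?; _×-dec_; _⊎-dec_)

-- Sums over finite sets

Σ[_] : ∀ {k} → (Fin k → ℕ) → ℕ
Σ[ f ] = sum +-0-commutativeMonoid f

sum-mono : ∀ {k} {f g : Fin k → ℕ} → (∀ i → f i ≤ g i) → Σ[ f ] ≤ Σ[ g ]
sum-mono {zero}  f≤g = z≤n
sum-mono {suc k} f≤g = +-mono-≤ (f≤g zero) (sum-mono (f≤g ∘ suc))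

sum-pos : ∀ {k} (f : Fin k → ℕ) → 1 ≤ Σ[ f ] → ∃[ i ] 1 ≤ f i
sum-pos {suc k} f 1≤Σ with f zero in eq
... | suc _ = zero , subst (1 ≤_) (sym eq) (s≤s z≤n)
... | zero with sum-pos (f ∘ suc) 1≤Σ
...   | i , 1≤fi = suc i , 1≤fi

-- Sets a term to zero instead of removing its index, so that repeated extraction stays within
-- `Fin k`.
omit : ∀ {k} → Fin k → (Fin k → ℕ) → Fin k → ℕ
omit i f j = if does (i ≟ j) then 0 else f j

omit-≢ : ∀ {k} {i j : Fin k} f → i ≢ j → omit i f j ≡ f j
omit-≢ {i = i} {j} f i≢j rewrite dec-false (i ≟ j) i≢j = refl

omit-pos : ∀ {k} (i : Fin k) f j → 1 ≤ omit i f j → i ≢ j × 1 ≤ f j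
omit-pos i f j 1≤ with i ≟ j
... | no i≢j = i≢j , 1≤

sum-omit : ∀ {k} (i : Fin k) f → Σ[ f ] ≡ f i + Σ[ omit i f ]
sum-omit {suc k} zero    f = refl
sum-omit {suc k} (suc i) f = begin
  f zero + Σ[ f ∘ suc ]                       ≡⟨ cong (f zero +_) (sum-omit i (f ∘ suc)) ⟩
  f zero + (f (suc i) + Σ[ omit i (f ∘ suc) ]) ≡⟨ sym (+-assoc (f zero) _ _) ⟩
  f zero + f (suc i) + Σ[ omit i (f ∘ suc) ]   ≡⟨ cong (_+ Σ[ omit i (f ∘ suc) ]) (+-comm (f zero) _) ⟩
  f (suc i) + f zero + Σ[ omit i (f ∘ suc) ]   ≡⟨ +-assoc (f (suc i)) _ _ ⟩
  f (suc i) + Σ[ omit (suc i) f ]              ∎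
  where open ≡-Reasoning

sum-two : ∀ {k} (f : Fin k → ℕ) → (∀ i → f i ≤ 1) → 2 ≤ Σ[ f ] →
          ∃[ i ] ∃[ j ] i ≢ j × 1 ≤ f i × 1 ≤ f j
sum-two f f≤1 2≤Σ with sum-pos f (≤-trans (s≤s z≤n) 2≤Σ)
... | i , 1≤fi
  with sum-pos (omit i f) (+-cancelˡ-≤ 1 _ _ (≤-trans (subst (2 ≤_) (sum-omit i f) 2≤Σ) (+-monoˡ-≤ _ (f≤1 i))))
... | j , 1≤ with omit-pos i f j 1≤
... | i≢j , 1≤fj = i , j , i≢j , 1≤fi , 1≤fj

sum-unique : ∀ {k} (f : Fin k → ℕ) {is : List (Fin k)} → Unique is → sumᴸ (map f is) ≤ Σ[ f ]
sum-unique f {[]}     []           = z≤n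
sum-unique f {i ∷ is} (i∉is ∷ uniq) = begin
  f i + sumᴸ (map f is)          ≡⟨ cong (f i +_) (omit-map i∉is) ⟩
  f i + sumᴸ (map (omit i f) is) ≤⟨ +-monoʳ-≤ (f i) (sum-unique (omit i f) uniq) ⟩
  f i + Σ[ omit i f ]                     ≡⟨ sym (sum-omit i f) ⟩
  Σ[ f ]                                  ∎
  where
  open ≤-Reasoning
  omit-map : ∀ {js} → All (i ≢_) js → sumᴸ (map f js) ≡ sumᴸ (map (omit i f) js)
  omit-map []         = refl
  omit-map (i≢j ∷ ps) = cong₂ _+_ (sym (omit-≢ f i≢j)) (omit-map ps)

ι : Bool → ℕ
ι true  = 1
ι false = 0

∣p∣≡sum : ∀ {k} (p : Subset k) → ∣ p ∣ ≡ Σ[ ι ∘ lookup p ]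
∣p∣≡sum []          = refl
∣p∣≡sum (true ∷ p)  = cong suc (∣p∣≡sum p)
∣p∣≡sum (false ∷ p) = ∣p∣≡sum p

∈⇒true : ∀ {k} {p : Subset k} {x} → x ∈ p → lookup p x ≡ true
∈⇒true = []=⇒lookup

true⇒∈ : ∀ {k} {p : Subset k} {x} → lookup p x ≡ true → x ∈ p
true⇒∈ {p = p} {x} = lookup⇒[]= x p

∈-tabulate⁻ : ∀ {k} {f : Fin k → Bool} {x} → x ∈ tabulate f → f x ≡ true
∈-tabulate⁻ {f = f} {x} x∈ = trans (sym (lookup∘tabulate f x)) (∈⇒true x∈)

∈-tabulate⁺ : ∀ {k} {f : Fin k → Bool} {x} → f x ≡ true → x ∈ tabulate f
∈-tabulate⁺ {f = f} {x} fx = true⇒∈ (trans (lookup∘tabulate f x) fx)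

x∈p─q⇒x∉q : ∀ {k} (p q : Subset k) {x} → x ∈ p ─ q → x ∉ q
x∈p─q⇒x∉q (_ ∷ p) (true ∷ q)  {zero}  ()
x∈p─q⇒x∉q (_ ∷ p) (false ∷ q) {zero}  _           ()
x∈p─q⇒x∉q (_ ∷ p) (_ ∷ q)     {suc x} (there x∈p─q) (there x∈q) = x∈p─q⇒x∉q p q x∈p─q x∈q

-- Sets of vertices and connectivity

VSet : ℕ → Set
VSet n = Fin n → Bool

infix  4 _∋_ _∌_ _⊑_
infixl 5 _∖_
infixl 6 _∪ᵛ_
infixl 7 _∩ᵛ_

-- Sets, their operations and membership are abstract because the Boolean
-- functions behind them would unfold and block the inference of implicit sets.
abstract

  _∋_ _∌_ : ∀ {n} → VSet n → Fin n → Set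
  A ∋ x = A x ≡ true
  A ∌ x = A x ≡ false

  _∖_ _∪ᵛ_ _∩ᵛ_ : ∀ {n} → VSet n → VSet n → VSet n
  (A ∖ B) x = A x ∧ not (B x)
  (A ∪ᵛ B) x = A x ∨ B x
  (A ∩ᵛ B) x = A x ∧ B x

  full : ∀ {n} → VSet n
  full _ = true

  ⟪_⟫ : ∀ {n} → Fin n → VSet n
  ⟪ v ⟫ x = does (x ≟ v)

  comprehension : ∀ {n} {P : Fin n → Set} → (∀ x → Dec (P x)) → VSet n
  comprehension P? x = does (P? x)

  χ : ∀ {n} → VSet n → Fin n → ℕ
  χ A x = if A x then 1 else 0

  member? : ∀ {n} (A : VSet n) x → A ∋ x ⊎ A ∌ x
  member? A x with A x
  ... | true  = inj₁ refl
  ... | false = inj₂ refl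

  ∋∌⇒⊥ : ∀ {n} {A : VSet n} {x} → A ∋ x → A ∌ x → ⊥
  ∋∌⇒⊥ Ax ¬Ax with trans (sym Ax) ¬Ax
  ... | ()

  full-∋ : ∀ {n} {x : Fin n} → full ∋ x
  full-∋ = refl

  ∖⁺ : ∀ {n} {A B : VSet n} {x} → A ∋ x → B ∌ x → A ∖ B ∋ x
  ∖⁺ Ax ¬Bx rewrite Ax | ¬Bx = refl

  ∖⁻ : ∀ {n} {A B : VSet n} {x} → A ∖ B ∋ x → A ∋ x × B ∌ x
  ∖⁻ {A = A} {B} {x} eq with A x | B x
  ... | true | false = refl , refl

  ∪⁺ˡ : ∀ {n} {A B : VSet n} {x} → A ∋ x → A ∪ᵛ B ∋ x
  ∪⁺ˡ Ax rewrite Ax = refl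

  ∪⁺ʳ : ∀ {n} {A B : VSet n} {x} → B ∋ x → A ∪ᵛ B ∋ x
  ∪⁺ʳ {A = A} {x = x} Bx rewrite Bx with A x
  ... | true  = refl
  ... | false = refl

  ∪⁻ : ∀ {n} {A B : VSet n} {x} → A ∪ᵛ B ∋ x → A ∋ x ⊎ B ∋ x
  ∪⁻ {A = A} {x = x} eq with A x
  ... | true  = inj₁ refl
  ... | false = inj₂ eq

  ∩⁺ : ∀ {n} {A B : VSet n} {x} → A ∋ x → B ∋ x → A ∩ᵛ B ∋ x
  ∩⁺ Ax Bx rewrite Ax | Bx = refl

  ∩⁻ : ∀ {n} {A B : VSet n} {x} → A ∩ᵛ B ∋ x → A ∋ x × B ∋ x
  ∩⁻ {A = A} {B} {x} eq with A x | B x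
  ... | true | true = refl , refl

  ⟪⟫⁺ : ∀ {n} {v : Fin n} → ⟪ v ⟫ ∋ v
  ⟪⟫⁺ {v = v} = dec-true (v ≟ v) refl

  ⟪⟫⁻ : ∀ {n} {v x : Fin n} → ⟪ v ⟫ ∋ x → x ≡ v
  ⟪⟫⁻ {v = v} {x} eq with x ≟ v
  ... | yes x≡v = x≡v

  comprehension⁺ : ∀ {n} {P : Fin n → Set} {P? : ∀ x → Dec (P x)} {x} → P x → comprehension P? ∋ x
  comprehension⁺ {P? = P?} {x} = dec-true (P? x)

  comprehension⁻ : ∀ {n} {P : Fin n → Set} {P? : ∀ x → Dec (P x)} {x} → comprehension P? ∋ x → P x
  comprehension⁻ {P? = P?} {x} eq with P? x
  ... | yes Px = Px

  ¬∋⇒∌ : ∀ {n} {A : VSet n} {x} → ¬ A ∋ x → A ∌ x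
  ¬∋⇒∌ = ¬-not

  χ-∋ : ∀ {n} {A : VSet n} {x} → A ∋ x → χ A x ≡ 1
  χ-∋ Ax rewrite Ax = refl

  χ-∌ : ∀ {n} {A : VSet n} {x} → A ∌ x → χ A x ≡ 0
  χ-∌ ¬Ax rewrite ¬Ax = refl

  χ-full : ∀ {n} {x : Fin n} → χ full x ≡ 1
  χ-full = refl

  χ-⟪⟫ : ∀ {n} {v x : Fin n} → χ ⟪ v ⟫ x ≡ ι (does (x ≟ v))
  χ-⟪⟫ {v = v} {x} with does (x ≟ v)
  ... | true  = refl
  ... | false = refl

∁ : ∀ {n} → VSet n → VSet n
∁ A = full ∖ A

_⊑_ : ∀ {n} → VSet n → VSet n → Set
A ⊑ B = ∀ {x} → A ∋ x → B ∋ x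

∖⊑ : ∀ {n} {A B : VSet n} → A ∖ B ⊑ A
∖⊑ = proj₁ ∘ ∖⁻

∖-∌ : ∀ {n} {A B : VSet n} {x} → A ∖ B ∋ x → B ∌ x
∖-∌ = proj₂ ∘ ∖⁻

∉⟪⟫ : ∀ {n} {v x : Fin n} → x ≢ v → ⟪ v ⟫ ∌ x
∉⟪⟫ x≢v = ¬∋⇒∌ (x≢v ∘ ⟪⟫⁻)

_∋?_ : ∀ {n} (A : VSet n) x → Dec (A ∋ x)
A ∋? x with member? A x
... | inj₁ Ax  = yes Ax
... | inj₂ ¬Ax = no λ Ax → ∋∌⇒⊥ Ax ¬Ax

∁⁺ : ∀ {n} {A : VSet n} {x} → A ∌ x → ∁ A ∋ x
∁⁺ = ∖⁺ full-∋

∁⁻ : ∀ {n} {A : VSet n} {x} → ∁ A ∋ x → A ∌ x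
∁⁻ = ∖-∌

∁-∌⁺ : ∀ {n} {A : VSet n} {x} → A ∋ x → ∁ A ∌ x
∁-∌⁺ Ax = ¬∋⇒∌ (∋∌⇒⊥ Ax ∘ ∁⁻)

∁-∌⁻ : ∀ {n} {A : VSet n} {x} → ∁ A ∌ x → A ∋ x
∁-∌⁻ {A = A} {x} ¬∁ with member? A x
... | inj₁ Ax  = Ax
... | inj₂ ¬Ax = ⊥-elim (∋∌⇒⊥ (∁⁺ ¬Ax) ¬∁)

∌-⊑ : ∀ {n} {A B : VSet n} {x} → A ⊑ B → B ∌ x → A ∌ x
∌-⊑ A⊑B ¬Bx = ¬∋⇒∌ λ Ax → ∋∌⇒⊥ (A⊑B Ax) ¬Bx

∖-∌⁺ : ∀ {n} {A B : VSet n} {x} → B ∋ x → A ∖ B ∌ x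
∖-∌⁺ Bx = ¬∋⇒∌ λ d → ∋∌⇒⊥ Bx (∖-∌ d)

∖-∌⁻ : ∀ {n} {A B : VSet n} {x} → A ∋ x → A ∖ B ∌ x → B ∋ x
∖-∌⁻ {B = B} {x} Ax ¬d with member? B x
... | inj₁ Bx  = Bx
... | inj₂ ¬Bx = ⊥-elim (∋∌⇒⊥ (∖⁺ Ax ¬Bx) ¬d)

∪-∌⁺ : ∀ {n} {A B : VSet n} {x} → A ∌ x → B ∌ x → A ∪ᵛ B ∌ x
∪-∌⁺ ¬Ax ¬Bx = ¬∋⇒∌ ([ (λ Ax → ∋∌⇒⊥ Ax ¬Ax) , (λ Bx → ∋∌⇒⊥ Bx ¬Bx) ]′ ∘ ∪⁻)

∪-∌⁻ : ∀ {n} {A B : VSet n} {x} → A ∪ᵛ B ∌ x → A ∌ x × B ∌ x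
∪-∌⁻ ¬x = ∌-⊑ ∪⁺ˡ ¬x , ∌-⊑ ∪⁺ʳ ¬x

≢-by : ∀ {n} {A : VSet n} {x y : Fin n} → A ∋ x → A ∌ y → x ≢ y
≢-by Ax Ay refl = ∋∌⇒⊥ Ax Ay

size : ∀ {n} → VSet n → ℕ
size A = Σ[ χ A ]

χ≤1 : ∀ {n} (A : VSet n) x → χ A x ≤ 1
χ≤1 A x with member? A x
... | inj₁ Ax  = ≤-reflexive (χ-∋ Ax)
... | inj₂ ¬Ax = ≤-trans (≤-reflexive (χ-∌ ¬Ax)) z≤n

χ-mono : ∀ {n} {A B : VSet n} → A ⊑ B → ∀ x → χ A x ≤ χ B x
χ-mono {A = A} A⊑B x with member? A x
... | inj₁ Ax  = ≤-reflexive (trans (χ-∋ Ax) (sym (χ-∋ (A⊑B Ax))))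
... | inj₂ ¬Ax = ≤-trans (≤-reflexive (χ-∌ ¬Ax)) z≤n

χ-split : ∀ {n} {A B : VSet n} → B ⊑ A → ∀ x → χ A x ≡ χ B x + χ (A ∖ B) x
χ-split {A = A} {B} B⊑A x with member? B x
... | inj₁ Bx = trans (χ-∋ (B⊑A Bx)) (sym (cong₂ _+_ (χ-∋ Bx) (χ-∌ (∖-∌⁺ Bx))))
... | inj₂ ¬Bx with member? A x
...   | inj₁ Ax  = trans (χ-∋ Ax) (sym (cong₂ _+_ (χ-∌ ¬Bx) (χ-∋ (∖⁺ Ax ¬Bx))))
...   | inj₂ ¬Ax = trans (χ-∌ ¬Ax) (sym (cong₂ _+_ (χ-∌ ¬Bx) (χ-∌ (∌-⊑ ∖⊑ ¬Ax))))

size-⊏ : ∀ {n} {A B : VSet n} {x} → A ⊑ B → B ∋ x → A ∌ x → size A < size B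
size-⊏ {A = A} {B} {x} A⊑B Bx ¬Ax = begin-strict
  size A                        ≡⟨ sum-omit x (χ A) ⟩
  χ A x + Σ[ omit x (χ A) ]     ≡⟨ cong (_+ Σ[ omit x (χ A) ]) (χ-∌ ¬Ax) ⟩
  Σ[ omit x (χ A) ]             ≤⟨ sum-mono omit-mono ⟩
  Σ[ omit x (χ B) ]             <⟨ n<1+n _ ⟩
  1 + Σ[ omit x (χ B) ]         ≡⟨ cong (_+ Σ[ omit x (χ B) ]) (sym (χ-∋ Bx)) ⟩
  χ B x + Σ[ omit x (χ B) ]     ≡⟨ sym (sum-omit x (χ B)) ⟩
  size B                        ∎
  where
  open ≤-Reasoning
  omit-mono : ∀ i → omit x (χ A) i ≤ omit x (χ B) i
  omit-mono i with x ≟ i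
  ... | yes _ = z≤n
  ... | no  _ = χ-mono A⊑B i

-- Walks, cuts and connectivity

module Joining {n m : ℕ} (ends : Ends n m) where

  Via : (Fin m → Set) → Fin n → Fin n → Set
  Via F u v = ∃[ g ] F g × Joins ends g u v

  joins-sym : ∀ {g u v} → Joins ends g u v → Joins ends g v u
  joins-sym = swap

  via-sym : ∀ {F u v} → Via F u v → Via F v u
  via-sym (g , Fg , j) = g , Fg , joins-sym j

  joins-ends : ∀ g → Joins ends g (proj₁ (ends g)) (proj₂ (ends g))
  joins-ends g = inj₁ refl

  joins-other : ∀ {g u v w} → Joins ends g u v → Joins ends g u w → v ≡ w
  joins-other (inj₁ p) (inj₁ q) = cong proj₂ (trans (sym p) q)
  joins-other (inj₂ p) (inj₂ q) = cong proj₁ (trans (sym p) q)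
  joins-other (inj₁ p) (inj₂ q) = trans (cong proj₂ r) (cong proj₁ r)
    where r = trans (sym p) q
  joins-other (inj₂ p) (inj₁ q) = trans (cong proj₁ r) (cong proj₂ r)
    where r = trans (sym p) q

  joins-pair : ∀ {g u v p q} → Joins ends g u v → Joins ends g p q → (u ≡ p × v ≡ q) ⊎ (u ≡ q × v ≡ p)
  joins-pair (inj₁ a) (inj₁ b) = inj₁ (cong proj₁ r , cong proj₂ r) where r = trans (sym a) b
  joins-pair (inj₂ a) (inj₂ b) = inj₁ (cong proj₂ r , cong proj₁ r) where r = trans (sym a) b
  joins-pair (inj₁ a) (inj₂ b) = inj₂ (cong proj₁ r , cong proj₂ r) where r = trans (sym a) b
  joins-pair (inj₂ a) (inj₁ b) = inj₂ (cong proj₂ r , cong proj₁ r) where r = trans (sym a) b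

  crossing : ∀ {R : Fin n → Fin n → Set} (U : VSet n) {x y} → Star R x y → U ∋ x → U ∌ y →
             ∃[ p ] ∃[ q ] R p q × U ∋ p × U ∌ q
  crossing U ε Ux Uy = ⊥-elim (∋∌⇒⊥ Ux Uy)
  crossing U (_◅_ {_} {z} r rs) Ux Uy with member? U z
  ... | inj₁ Uz = crossing U rs Uz Uy
  ... | inj₂ Uz = _ , z , r , Ux , Uz

  Crosses : (Fin m → Set) → (Fin n → Set) → VSet n → Set
  Crosses F P U = ∃[ g ] ∃[ p ] ∃[ q ] F g × Joins ends g p q × P p × P q × U ∋ p × U ∌ q

  -- Connectivity of the graph with vertices P and edges F, in the cut form: every
  -- set of vertices that separates two elements of P is crossed by an edge.
  Conn : (Fin m → Set) → (Fin n → Set) → Set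
  Conn F P = ∀ (U : VSet n) {x y} → P x → P y → U ∋ x → U ∌ y → Crosses F P U

  crosses-mono : ∀ {F F′ P P′ U} → (∀ {g} → F g → F′ g) → (∀ {x} → P x → P′ x) → Crosses F P U → Crosses F′ P′ U
  crosses-mono f h (g , p , q , Fg , j , Pp , Pq , Up , Uq) = g , p , q , f Fg , j , h Pp , h Pq , Up , Uq

  crosses-∁ : ∀ {F P U} → Crosses F P (∁ U) → Crosses F P U
  crosses-∁ (g , p , q , Fg , j , Pp , Pq , Up , Uq) =
    g , q , p , Fg , joins-sym j , Pq , Pp , ∁-∌⁻ Uq , ∁⁻ Up

  -- A set and its complement are crossed by the same edges, so the separating set may be assumed to
  -- contain `o`.
  conn-from : ∀ {F P} o → (∀ U {y} → U ∋ o → P y → U ∌ y → Crosses F P U) → Conn F P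
  conn-from o h U Px Py Ux Uy with member? U o
  ... | inj₁ Uo = h U Uo Py Uy
  ... | inj₂ Uo = crosses-∁ (h (∁ U) (∁⁺ Uo) Px (∁-∌⁺ Ux))

  conn-singleton : ∀ {F} v → Conn F (⟪ v ⟫ ∋_)
  conn-singleton v U x∈ y∈ Ux Uy with ⟪⟫⁻ x∈ | ⟪⟫⁻ y∈
  ... | refl | refl = ⊥-elim (∋∌⇒⊥ Ux Uy)

  conn-add : ∀ {F A g a w} → Conn F (A ∋_) → A ∋ a → F g → Joins ends g a w → Conn F (A ∪ᵛ ⟪ w ⟫ ∋_)
  conn-add {F} {A} {g} {a} {w} conn Aa Fg j = conn-from a from-a
    where
    from-a : ∀ U {y} → U ∋ a → A ∪ᵛ ⟪ w ⟫ ∋ y → U ∌ y → Crosses F (A ∪ᵛ ⟪ w ⟫ ∋_) U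
    from-a U Ua Ay Uy with ∪⁻ Ay
    ... | inj₁ Ay′ = crosses-mono id ∪⁺ˡ (conn U Aa Ay′ Ua Uy)
    ... | inj₂ y∈ with ⟪⟫⁻ y∈
    ...   | refl = g , a , w , Fg , j , ∪⁺ˡ Aa , ∪⁺ʳ ⟪⟫⁺ , Ua , Uy

  -- The set of vertices reached from `u` is enlarged by the far end of an edge that crosses it,
  -- until it contains `v`; its complement shrinks each time.
  conn⇒star : ∀ {F P u v} → Conn F P → P u → P v → Star (Via F) u v
  conn⇒star {F} {P} {u} {v} conn Pu Pv =
    grow _ ⟪ u ⟫ ≤-refl ⟪⟫⁺
      (λ x∈ → subst P (sym (⟪⟫⁻ x∈)) Pu)
      (λ x∈ → subst (Star (Via F) u) (sym (⟪⟫⁻ x∈)) ε)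
    where
    grow : ∀ k (C : VSet n) → size (∁ C) ≤ k → C ∋ u → (∀ {x} → C ∋ x → P x) →
           (∀ {x} → C ∋ x → Star (Via F) u x) → Star (Via F) u v
    grow k C ≤k Cu C⇒P C⇒star with member? C v
    ... | inj₁ Cv = C⇒star Cv
    ... | inj₂ Cv with conn C Pu Pv Cu Cv
    ... | g , p , q , Fg , j , Pp , Pq , Cp , Cq with ≤-trans (size-⊏ C′-shrinks (∁⁺ Cq) (∁-∌⁺ (∪⁺ʳ ⟪⟫⁺))) ≤k
      where
      C′-shrinks : ∁ (C ∪ᵛ ⟪ q ⟫) ⊑ ∁ C
      C′-shrinks = ∁⁺ ∘ proj₁ ∘ ∪-∌⁻ ∘ ∁⁻
    ... | s≤s ≤k′ =
      grow _ (C ∪ᵛ ⟪ q ⟫) ≤k′ (∪⁺ˡ Cu)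
        ([ C⇒P , (λ x∈ → subst P (sym (⟪⟫⁻ x∈)) Pq) ]′ ∘ ∪⁻)
        ([ C⇒star , (λ x∈ → subst (Star (Via F) u) (sym (⟪⟫⁻ x∈)) (C⇒star Cp ◅◅ (g , Fg , j) ◅ ε)) ]′ ∘ ∪⁻)

  star⇒conn : ∀ {F P} → (∀ {g x y} → F g → Joins ends g x y → P x × P y) →
              (∀ {x y} → P x → P y → Star (Via F) x y) → Conn F P
  star⇒conn F⇒P star U Px Py Ux Uy with crossing U (star Px Py) Ux Uy
  ... | p , q , (g , Fg , j) , Up , Uq = g , p , q , Fg , j , proj₁ (F⇒P Fg j) , proj₂ (F⇒P Fg j) , Up , Uq

-- Counting edges

does-sound : ∀ {P : Set} (P? : Dec P) → does P? ≡ true → P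
does-sound (yes p) _ = p

module Counting {n m : ℕ} {ends : Ends n m} (G : Graph ends) where

  open Joining ends public

  weight : VSet n → VSet n → Fin m → ℕ
  weight A B g = ι (lookup (E G) g) *
    (χ A (proj₁ (ends g)) * χ B (proj₂ (ends g)) + χ A (proj₂ (ends g)) * χ B (proj₁ (ends g)))

  -- An edge with both ends in A ∩ B counts twice, so a loop counts as in degree.
  link : VSet n → VSet n → ℕ
  link A B = Σ[ weight A B ]

  link-sym : ∀ A B → link A B ≡ link B A
  link-sym A B = sum-cong-≗ +-0-commutativeMonoid λ g → cong (ι (lookup (E G) g) *_)
    (trans (+-comm (χ A (proj₁ (ends g)) * _) _)
      (cong₂ _+_ (*-comm (χ A (proj₂ (ends g))) _) (*-comm (χ A (proj₁ (ends g))) _)))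

  link-splitˡ : ∀ {A B} D → B ⊑ A → link A D ≡ link B D + link (A ∖ B) D
  link-splitˡ {A} {B} D B⊑A = trans (sum-cong-≗ +-0-commutativeMonoid pointwise)
                                    (∑-distrib-+ +-0-commutativeMonoid (weight B D) (weight (A ∖ B) D))
    where
    open +-*-Solver
    pointwise : ∀ g → weight A D g ≡ weight B D g + weight (A ∖ B) D g
    pointwise g rewrite χ-split B⊑A (proj₁ (ends g)) | χ-split B⊑A (proj₂ (ends g)) =
      solve 7 (λ l b d y b′ d′ y′ → l :* ((b :+ d) :* y :+ (b′ :+ d′) :* y′)
                 := l :* (b :* y :+ b′ :* y′) :+ l :* (d :* y :+ d′ :* y′)) refl
        (ι (lookup (E G) g)) (χ B (proj₁ (ends g))) (χ (A ∖ B) (proj₁ (ends g))) (χ D (proj₂ (ends g)))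
        (χ B (proj₂ (ends g))) (χ (A ∖ B) (proj₂ (ends g))) (χ D (proj₁ (ends g)))

  link-splitʳ : ∀ {A B} D → B ⊑ A → link D A ≡ link D B + link D (A ∖ B)
  link-splitʳ {A} {B} D B⊑A = begin
    link D A                    ≡⟨ link-sym D A ⟩
    link A D                    ≡⟨ link-splitˡ D B⊑A ⟩
    link B D + link (A ∖ B) D   ≡⟨ cong₂ _+_ (link-sym B D) (link-sym (A ∖ B) D) ⟩
    link D B + link D (A ∖ B)   ∎
    where open ≡-Reasoning

  link-mono : ∀ {A A′ B B′} → A ⊑ A′ → B ⊑ B′ → link A B ≤ link A′ B′
  link-mono A⊑ B⊑ = sum-mono λ g → *-monoʳ-≤ (ι (lookup (E G) g))
    (+-mono-≤ (*-mono-≤ (χ-mono A⊑ _) (χ-mono B⊑ _)) (*-mono-≤ (χ-mono A⊑ _) (χ-mono B⊑ _)))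

  weight-edge : ∀ A B g → 1 ≤ weight A B g → g ∈ E G × ∃[ p ] ∃[ q ] Joins ends g p q × A ∋ p × B ∋ q
  weight-edge A B g 1≤ with lookup (E G) g in g∈ 
  ... | true with member? A (proj₁ (ends g)) | member? B (proj₂ (ends g))
  ...   | inj₁ Ap | inj₁ Bq = true⇒∈ g∈ , _ , _ , inj₁ refl , Ap , Bq
  ...   | inj₂ Ap | _ rewrite χ-∌ Ap = true⇒∈ g∈ , other
    where
    other : ∃[ p ] ∃[ q ] Joins ends g p q × A ∋ p × B ∋ q
    other with member? A (proj₂ (ends g)) | member? B (proj₁ (ends g))
    ... | inj₁ Ap′ | inj₁ Bq′ = _ , _ , inj₂ refl , Ap′ , Bq′
    ... | inj₂ Ap′ | _ rewrite χ-∌ Ap′ = contradiction 1≤ λ ()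
    ... | inj₁ _ | inj₂ Bq′ rewrite χ-∌ Bq′ | *-zeroʳ (χ A (proj₂ (ends g))) = contradiction 1≤ λ ()
  weight-edge A B g 1≤ | true | inj₁ _ | inj₂ Bq rewrite χ-∌ Bq | *-zeroʳ (χ A (proj₁ (ends g))) = true⇒∈ g∈ , other
    where
    other : ∃[ p ] ∃[ q ] Joins ends g p q × A ∋ p × B ∋ q
    other with member? A (proj₂ (ends g)) | member? B (proj₁ (ends g))
    ... | inj₁ Ap′ | inj₁ Bq′ = _ , _ , inj₂ refl , Ap′ , Bq′
    ... | inj₂ Ap′ | _ rewrite χ-∌ Ap′ = contradiction 1≤ λ ()
    ... | inj₁ _ | inj₂ Bq′ rewrite χ-∌ Bq′ | *-zeroʳ (χ A (proj₂ (ends g))) = contradiction 1≤ λ ()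

  edge-weight : ∀ {A B g p q} → g ∈ E G → Joins ends g p q → A ∋ p → B ∋ q → 1 ≤ weight A B g
  edge-weight {A} {B} {g} g∈ (inj₁ eq) Ap Bq
    rewrite ∈⇒true g∈ | cong proj₁ eq | cong proj₂ eq | χ-∋ Ap | χ-∋ Bq = s≤s z≤n
  edge-weight {A} {B} {g} g∈ (inj₂ eq) Ap Bq
    rewrite ∈⇒true g∈ | cong proj₁ eq | cong proj₂ eq | χ-∋ Ap | χ-∋ Bq =
    ≤-trans (m≤n+m 1 _) (m≤m+n _ 0)

  loop-weight : ∀ {A g p} → g ∈ E G → Joins ends g p p → A ∋ p → 2 ≤ weight A full g
  loop-weight {A} {g} {p} g∈ j Ap with joins-pair j (joins-ends g)
  ... | inj₁ (u≡ , v≡) rewrite ∈⇒true g∈ | sym u≡ | sym v≡ | χ-∋ Ap | χ-full {x = p} = ≤-refl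
  ... | inj₂ (u≡ , v≡) rewrite ∈⇒true g∈ | sym u≡ | sym v≡ | χ-∋ Ap | χ-full {x = p} = ≤-refl

  weight≤1 : ∀ {A B} → (∀ {x} → A ∋ x → B ∋ x → ⊥) → ∀ g → weight A B g ≤ 1
  weight≤1 {A} {B} disjoint g = *-mono-≤ (ι≤1 (lookup (E G) g)) (pair (proj₁ (ends g)) (proj₂ (ends g)))
    where
    ι≤1 : ∀ b → ι b ≤ 1
    ι≤1 true  = ≤-refl
    ι≤1 false = z≤n
    pair : ∀ u v → χ A u * χ B v + χ A v * χ B u ≤ 1
    pair u v with member? A u
    ... | inj₂ ¬Au rewrite χ-∌ ¬Au = *-mono-≤ (χ≤1 A v) (χ≤1 B u)
    ... | inj₁ Au rewrite χ-∌ {A = B} {u} (¬∋⇒∌ (disjoint Au)) | *-zeroʳ (χ A v) | +-identityʳ (χ A u * χ B v) =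
      *-mono-≤ (χ≤1 A u) (χ≤1 B v)

  Edge : VSet n → VSet n → Set
  Edge A B = ∃[ g ] g ∈ E G × ∃[ p ] ∃[ q ] Joins ends g p q × A ∋ p × B ∋ q

  link⇒edge : ∀ {A B} → 1 ≤ link A B → Edge A B
  link⇒edge {A} {B} 1≤ with sum-pos (weight A B) 1≤
  ... | g , 1≤w with weight-edge A B g 1≤w
  ... | g∈ , e = g , g∈ , e

  weight≤link : ∀ A B g → weight A B g ≤ link A B
  weight≤link A B g = ≤-trans (m≤m+n _ _) (≤-reflexive (sym (sum-omit g (weight A B))))

  edge⇒link : ∀ {A B g p q} → g ∈ E G → Joins ends g p q → A ∋ p → B ∋ q → 1 ≤ link A B
  edge⇒link {A} {B} {g} g∈ j Ap Bq = ≤-trans (edge-weight g∈ j Ap Bq) (weight≤link A B g)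

  no-edge⇒link≡0 : ∀ {A B} → (∀ {g p q} → g ∈ E G → Joins ends g p q → A ∋ p → B ∋ q → ⊥) → link A B ≡ 0
  no-edge⇒link≡0 {A} {B} none with link A B in eq
  ... | zero = refl
  ... | suc _ with link⇒edge {A} {B} (subst (1 ≤_) (sym eq) (s≤s z≤n))
  ...   | g , g∈ , p , q , j , Ap , Bq = ⊥-elim (none g∈ j Ap Bq)

  link⇒two-edges : ∀ {A B} → (∀ {x} → A ∋ x → B ∋ x → ⊥) → 2 ≤ link A B →
    ∃[ g ] ∃[ h ] g ≢ h × (g ∈ E G × ∃[ p ] ∃[ q ] Joins ends g p q × A ∋ p × B ∋ q)
                        × (h ∈ E G × ∃[ p ] ∃[ q ] Joins ends h p q × A ∋ p × B ∋ q)
  link⇒two-edges {A} {B} disjoint 2≤ with sum-two (weight A B) (weight≤1 disjoint) 2≤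
  ... | g , h , g≢h , 1≤g , 1≤h = g , h , g≢h , weight-edge A B g 1≤g , weight-edge A B h 1≤h

  link⇒two-edges-avoiding : ∀ {A B} c → (∀ {x} → A ∋ x → B ∋ x → ⊥) → 3 ≤ link A B →
    ∃[ g ] ∃[ h ] g ≢ h × (g ≢ c × g ∈ E G × ∃[ p ] ∃[ q ] Joins ends g p q × A ∋ p × B ∋ q)
                        × (h ≢ c × h ∈ E G × ∃[ p ] ∃[ q ] Joins ends h p q × A ∋ p × B ∋ q)
  link⇒two-edges-avoiding {A} {B} c disjoint 3≤
    with sum-two (omit c (weight A B)) omit≤1
           (+-cancelˡ-≤ 1 2 _ (≤-trans (≤-trans 3≤ (≤-reflexive (sum-omit c (weight A B)))) (+-monoˡ-≤ _ (weight≤1 disjoint c))))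
    where
    omit≤1 : ∀ g → omit c (weight A B) g ≤ 1
    omit≤1 g with c ≟ g
    ... | yes _ = z≤n
    ... | no  _ = weight≤1 disjoint g
  ... | g , h , g≢h , 1≤g , 1≤h with omit-pos c (weight A B) g 1≤g | omit-pos c (weight A B) h 1≤h
  ... | c≢g , 1≤g′ | c≢h , 1≤h′ = g , h , g≢h ,
    (≢-sym c≢g , weight-edge A B g 1≤g′) , (≢-sym c≢h , weight-edge A B h 1≤h′)

  degree≡link : ∀ v → degree G v ≡ link ⟪ v ⟫ full
  degree≡link v = begin
    ∣ E G ∩ tabulate f ∣ + ∣ E G ∩ tabulate f′ ∣
      ≡⟨ cong₂ _+_ (card f) (card f′) ⟩
    Σ[ (λ g → ι (lookup (E G) g) * ι (f g)) ] + Σ[ (λ g → ι (lookup (E G) g) * ι (f′ g)) ]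
      ≡⟨ sym (∑-distrib-+ +-0-commutativeMonoid (λ g → ι (lookup (E G) g) * ι (f g)) (λ g → ι (lookup (E G) g) * ι (f′ g))) ⟩
    Σ[ (λ g → ι (lookup (E G) g) * ι (f g) + ι (lookup (E G) g) * ι (f′ g)) ]
      ≡⟨ sum-cong-≗ +-0-commutativeMonoid pointwise ⟩
    link ⟪ v ⟫ full ∎
    where
    open ≡-Reasoning
    f f′ : Fin m → Bool
    f  g = does (proj₁ (ends g) ≟ v)
    f′ g = does (proj₂ (ends g) ≟ v)
    ι-∧ : ∀ a b → ι (a ∧ b) ≡ ι a * ι b
    ι-∧ true  b = sym (+-identityʳ (ι b))
    ι-∧ false b = refl
    card : ∀ h → ∣ E G ∩ tabulate h ∣ ≡ Σ[ (λ g → ι (lookup (E G) g) * ι (h g)) ]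
    card h = trans (∣p∣≡sum (E G ∩ tabulate h)) (sum-cong-≗ +-0-commutativeMonoid λ g →
      trans (cong ι (trans (lookup-zipWith _∧_ g (E G) (tabulate h)) (cong (lookup (E G) g ∧_) (lookup∘tabulate h g))))
            (ι-∧ (lookup (E G) g) (h g)))
    pointwise : ∀ g → ι (lookup (E G) g) * ι (f g) + ι (lookup (E G) g) * ι (f′ g) ≡ weight ⟪ v ⟫ full g
    pointwise g rewrite χ-⟪⟫ {v = v} {proj₁ (ends g)} | χ-⟪⟫ {v = v} {proj₂ (ends g)}
      | χ-full {x = proj₁ (ends g)} | χ-full {x = proj₂ (ends g)} | *-identityʳ (ι (f g)) | *-identityʳ (ι (f′ g)) =
      sym (*-distribˡ-+ (ι (lookup (E G) g)) (ι (f g)) (ι (f′ g)))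

  crossing-edges : VSet n → Subset m
  crossing-edges U = tabulate λ g → does (1 ≤? weight U (∁ U) g)

  crossing-edges⊆E : ∀ U → crossing-edges U ⊆ E G
  crossing-edges⊆E U {g} g∈ = proj₁ (weight-edge U (∁ U) g (does-sound (1 ≤? weight U (∁ U) g)
    (∈-tabulate⁻ {f = λ h → does (1 ≤? weight U (∁ U) h)} g∈)))

  ∣crossing-edges∣≤ : ∀ U → ∣ crossing-edges U ∣ ≤ link U (∁ U)
  ∣crossing-edges∣≤ U = ≤-trans (≤-reflexive (∣p∣≡sum (crossing-edges U))) (sum-mono λ g →
    ≤-trans (≤-reflexive (cong ι (lookup∘tabulate (λ h → does (1 ≤? weight U (∁ U) h)) g))) (positive (weight U (∁ U) g)))
    where
    positive : ∀ k → ι (does (1 ≤? k)) ≤ k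
    positive zero    = z≤n
    positive (suc k) = s≤s z≤n

  module _ (connected : EdgeConnected 3 G) where

    -- Every crossing edge contributes at least 1 to `link U (∁ U)`. If that were below 3, the
    -- crossing edges could be deleted, yet a walk from `x` to `y` in the rest would have to use one
    -- of them.
    3≤cut : ∀ U {x y} → x ∈ V G → y ∈ V G → U ∋ x → U ∌ y → 3 ≤ link U (∁ U)
    3≤cut U x∈ y∈ Ux Uy with 3 ≤? link U (∁ U)
    ... | yes 3≤ = 3≤
    ... | no ¬3≤ with crossing U (connected (crossing-edges U) (crossing-edges⊆E U)
                        (≤-<-trans (∣crossing-edges∣≤ U) (≰⇒> ¬3≤)) x∈ y∈) Ux Uy
    ...   | p , q , (g , g∈ , j) , Up , Uq = ⊥-elim (x∈p─q⇒x∉q (E G) (crossing-edges U) g∈ g∈δ)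
      where
      g∈E : g ∈ E G
      g∈E = p─q⊆p (E G) (crossing-edges U) g∈
      g∈δ : g ∈ crossing-edges U
      g∈δ = ∈-tabulate⁺ (dec-true (1 ≤? weight U (∁ U) g) (edge-weight g∈E j Up (∁⁺ Uq)))

-- Ears

module Ears {n m : ℕ} {ends : Ends n m} (G : Graph ends) (connected : EdgeConnected 3 G) (cubic : Cubic G) where

  open Counting G public

  ConnG : VSet n → Set
  ConnG A = Conn (_∈ E G) (A ∋_)

  Closed-in : VSet n → VSet n → Set
  Closed-in T C = ∀ {g p q} → g ∈ E G → Joins ends g p q → C ∋ p → T ∋ q → C ∋ q

  component : ∀ T {v} → T ∋ v → ∃[ C ] C ⊑ T × C ∋ v × Closed-in T C × ConnG C
  component T {v} Tv = grow _ ⟪ v ⟫ ≤-refl (λ x∈ → subst (T ∋_) (sym (⟪⟫⁻ x∈)) Tv) ⟪⟫⁺ (conn-singleton v)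
    where
    grow : ∀ k C → size (T ∖ C) ≤ k → C ⊑ T → C ∋ v → ConnG C →
           ∃[ C ] C ⊑ T × C ∋ v × Closed-in T C × ConnG C
    grow k C ≤k C⊑T Cv conn with 1 ≤? link C (T ∖ C)
    ... | no ¬1≤ = C , C⊑T , Cv , closed , conn
      where
      closed : Closed-in T C
      closed {g} {p} {q} g∈ j Cp Tq with member? C q
      ... | inj₁ Cq  = Cq
      ... | inj₂ ¬Cq = ⊥-elim (¬1≤ (edge⇒link g∈ j Cp (∖⁺ Tq ¬Cq)))
    ... | yes 1≤ with link⇒edge 1≤
    ... | g , g∈ , p , q , j , Cp , TCq with ≤-trans (size-⊏ shrinks TCq (∖-∌⁺ (∪⁺ʳ ⟪⟫⁺))) ≤k
      where
      shrinks : T ∖ (C ∪ᵛ ⟪ q ⟫) ⊑ T ∖ C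
      shrinks x∈ = ∖⁺ (∖⊑ x∈) (proj₁ (∪-∌⁻ (∖-∌ x∈)))
    ... | s≤s ≤k′ = grow _ (C ∪ᵛ ⟪ q ⟫) ≤k′
      ([ C⊑T , (λ x∈ → subst (T ∋_) (sym (⟪⟫⁻ x∈)) (∖⊑ TCq)) ]′ ∘ ∪⁻) (∪⁺ˡ Cv) (conn-add conn Cp g∈ j)

  -- Within `S`, an edge leaving `C` ends in `P`. Hence the vertices of `S` outside `U`, `P` and `C`
  -- are left by an edge that does not end in `C`: it ends in `U` and is itself the crossing edge,
  -- or in the part of `P` outside `U`, and then `P` supplies one.
  peel : ∀ {S P C o} → ConnG S → ConnG P → P ∋ o → P ⊑ S → C ⊑ S ∖ P → Closed-in (S ∖ P) C → ConnG (S ∖ C)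
  peel {S} {P} {C} {o} connS connP Po P⊑S C⊑ closed = conn-from o from-o
    where
    P⊑S∖C : P ⊑ S ∖ C
    P⊑S∖C Px = ∖⁺ (P⊑S Px) (¬∋⇒∌ λ Cx → ∋∌⇒⊥ Px (∖-∌ (C⊑ Cx)))
    from-o : ∀ U {y} → U ∋ o → S ∖ C ∋ y → U ∌ y → Crosses (_∈ E G) (S ∖ C ∋_) U
    from-o U {y} Uo SCy Uy with member? P y
    ... | inj₁ Py = crosses-mono id P⊑S∖C (connP U Po Py Uo Uy)
    ... | inj₂ ¬Py with connS (∁ (U ∪ᵛ P ∪ᵛ C)) (∖⊑ SCy) (P⊑S Po)
                         (∁⁺ (∪-∌⁺ (∪-∌⁺ Uy ¬Py) (∖-∌ SCy))) (∁-∌⁺ (∪⁺ˡ (∪⁺ˡ Uo)))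
    ... | g , p , q , g∈ , j , Sp , Sq , outside-p , inside-q
      with ∪-∌⁻ (∁⁻ outside-p) | ∪⁻ (∁-∌⁻ inside-q)
    ...   | ¬UPp , ¬Cp | inj₂ Cq = ⊥-elim (∋∌⇒⊥ (closed g∈ (joins-sym j) Cq (∖⁺ Sp (proj₂ (∪-∌⁻ ¬UPp)))) ¬Cp)
    ...   | ¬UPp , ¬Cp | inj₁ UPq with ∪⁻ UPq | member? U q
    ...     | inj₂ Pq | inj₂ ¬Uq = crosses-mono id P⊑S∖C (connP U Po Pq Uo ¬Uq)
    ...     | inj₁ Uq | inj₂ ¬Uq = ⊥-elim (∋∌⇒⊥ Uq ¬Uq)
    ...     | _       | inj₁ Uq  = g , q , p , g∈ , joins-sym j , ∖⁺ Sq ¬Cq , ∖⁺ Sp ¬Cp , Uq , proj₁ (∪-∌⁻ ¬UPp)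
      where
      ¬Cq : C ∌ q
      ¬Cq = ¬∋⇒∌ λ Cq → ∋∌⇒⊥ (closed g∈ (joins-sym j) Cq (∖⁺ Sp (proj₂ (∪-∌⁻ ¬UPp)))) ¬Cp

  degree≡3 : ∀ {v} → v ∈ V G → link ⟪ v ⟫ full ≡ 3
  degree≡3 {v} v∈ = trans (sym (degree≡link v)) (cubic v∈)

  module Region (Y : VSet n) (Y⊆V : ∀ {x} → Y ∋ x → x ∈ V G) (z : Fin n) (Yz : Y ∋ z) (connY : ConnG Y)
                (anchor : 1 ≤ link ⟪ z ⟫ (∁ Y)) where

    record Ear : Set where
      field
        W      : VSet n
        W⊑Y    : W ⊑ Y
        z∉W    : W ∌ z
        conn-W : ConnG W
        conn-K : ConnG (Y ∖ W)
        feet   : 2 ≤ link W (∁ Y)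

    open Ear

    -- `M` is the component of `y` in `Y` without `z`, so the edges leaving it go to `z` or out of
    -- `Y`. When `z` also has an edge to another component, that edge and `anchor` leave at most one
    -- for `M`, and two of the at least three edges of the cut at `M` must leave `Y`.
    initial : ∀ {y} → Y ∋ y → y ≢ z → Ear
    initial {y} Yy y≢z with component (Y ∖ ⟪ z ⟫) (∖⁺ Yy (∉⟪⟫ y≢z))
    ... | M , M⊑ , My , closed , connM = record
      { W = M ; W⊑Y = ∖⊑ ∘ M⊑ ; z∉W = ¬Mz ; conn-W = connM
      ; conn-K = peel connY (conn-singleton z) ⟪⟫⁺ z⊑Y M⊑ closed
      ; feet = feet-M
      }
      where
      z⊑Y : ⟪ z ⟫ ⊑ Y
      z⊑Y x∈ = subst (Y ∋_) (sym (⟪⟫⁻ x∈)) Yz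
      ¬Mz : M ∌ z
      ¬Mz = ¬∋⇒∌ λ Mz → ∋∌⇒⊥ ⟪⟫⁺ (∖-∌ (M⊑ Mz))
      rest : VSet n
      rest = Y ∖ ⟪ z ⟫ ∖ M
      zX = link ⟪ z ⟫ (∁ Y)
      zM = link ⟪ z ⟫ M
      zR = link ⟪ z ⟫ rest
      mX = link M (∁ Y)
      deg-z : zX + (zM + zR) ≤ 3
      deg-z = begin
        zX + (zM + zR)                          ≡⟨ cong (zX +_) (sym (link-splitʳ ⟪ z ⟫ M⊑)) ⟩
        zX + link ⟪ z ⟫ (Y ∖ ⟪ z ⟫)             ≤⟨ +-monoʳ-≤ zX (link-mono id ∖⊑) ⟩
        zX + link ⟪ z ⟫ Y                       ≡⟨ +-comm zX _ ⟩
        link ⟪ z ⟫ Y + zX                       ≡⟨ sym (link-splitʳ ⟪ z ⟫ (λ _ → full-∋)) ⟩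
        link ⟪ z ⟫ full                         ≡⟨ degree≡3 (Y⊆V Yz) ⟩
        3 ∎
        where open ≤-Reasoning
      no-rest : link M rest ≡ 0
      no-rest = no-edge⇒link≡0 λ g∈ j Mp Rq → ∋∌⇒⊥ (closed g∈ j Mp (∖⊑ Rq)) (∖-∌ Rq)
      cut-M : 3 ≤ mX + zM
      cut-M = begin
        3                                             ≤⟨ 3≤cut connected M (Y⊆V Yy) (Y⊆V Yz) My ¬Mz ⟩
        link M (∁ M)                                  ≤⟨ ∁M-cover ⟩
        link M (∁ Y) + (link M ⟪ z ⟫ + link M rest)   ≡⟨ cong₂ (λ a b → mX + (a + b)) (link-sym M ⟪ z ⟫) no-rest ⟩
        mX + (zM + 0)                                 ≡⟨ cong (mX +_) (+-identityʳ zM) ⟩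
        mX + zM ∎
        where
        open ≤-Reasoning
        ∁Y⊑∁M : ∁ Y ⊑ ∁ M
        ∁Y⊑∁M x∈ = ∁⁺ (∌-⊑ (∖⊑ ∘ M⊑) (∁⁻ x∈))
        remaining : ∁ M ∖ ∁ Y ⊑ Y ∖ M
        remaining x∈ = ∖⁺ (∁-∌⁻ (∖-∌ x∈)) (∁⁻ (∖⊑ x∈))
        z⊑Y∖M : ⟪ z ⟫ ⊑ Y ∖ M
        z⊑Y∖M x∈ = ∖⁺ (z⊑Y x∈) (subst (M ∌_) (sym (⟪⟫⁻ x∈)) ¬Mz)
        swap-∖ : Y ∖ M ∖ ⟪ z ⟫ ⊑ rest
        swap-∖ x∈ = ∖⁺ (∖⁺ (∖⊑ (∖⊑ x∈)) (∖-∌ x∈)) (∖-∌ (∖⊑ x∈))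
        ∁M-cover : link M (∁ M) ≤ link M (∁ Y) + (link M ⟪ z ⟫ + link M rest)
        ∁M-cover = begin
          link M (∁ M)                                    ≡⟨ link-splitʳ M ∁Y⊑∁M ⟩
          mX + link M (∁ M ∖ ∁ Y)                         ≤⟨ +-monoʳ-≤ mX (link-mono id remaining) ⟩
          mX + link M (Y ∖ M)                             ≡⟨ cong (mX +_) (link-splitʳ M z⊑Y∖M) ⟩
          mX + (link M ⟪ z ⟫ + link M (Y ∖ M ∖ ⟪ z ⟫))    ≤⟨ +-monoʳ-≤ mX (+-monoʳ-≤ (link M ⟪ z ⟫) (link-mono id swap-∖)) ⟩
          mX + (link M ⟪ z ⟫ + link M rest)               ∎
      feet-M : 2 ≤ mX
      feet-M with 1 ≤? zR
      ... | yes 1≤zR = +-cancelʳ-≤ 1 2 mX (≤-trans cut-M (+-monoʳ-≤ mX zM≤1))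
        where
        zM≤1 : zM ≤ 1
        zM≤1 = +-cancelʳ-≤ 1 zM 1 (≤-trans (+-monoʳ-≤ zM 1≤zR)
          (+-cancelˡ-≤ 1 _ 2 (≤-trans (+-monoˡ-≤ (zM + zR) anchor) deg-z)))
      -- Now `Y` is `M` together with `z`. With `mX` at most 1, adding the cuts of `Y` and `M` gives
      -- 6 ≤ `zX` + `zM` + 2, while `z` has degree 3.
      ... | no ¬1≤zR = ≮⇒≥ λ mX<2 → 1+n≰n (total mX<2)
        where
        rest-∌ : ∀ {x} → rest ∋ x → ⊥
        rest-∌ Rx with connY rest (∖⊑ (∖⊑ Rx)) Yz Rx (∌-⊑ ∖⊑ (∖-∌⁺ ⟪⟫⁺))
        ... | g , p , q , g∈ , j , Yp , Yq , Rp , ¬Rq with member? M q | q ≟ z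
        ...   | _       | yes refl = ¬1≤zR (edge⇒link g∈ (joins-sym j) ⟪⟫⁺ Rp)
        ...   | inj₁ Mq | no _     = ∋∌⇒⊥ (closed g∈ (joins-sym j) Mq (∖⊑ Rp)) (∖-∌ Rp)
        ...   | inj₂ ¬Mq | no q≢z  = ∋∌⇒⊥ (∖⁺ (∖⁺ Yq (∉⟪⟫ q≢z)) ¬Mq) ¬Rq
        Y⊑M : Y ∖ ⟪ z ⟫ ⊑ M
        Y⊑M {x} Yx with member? M x
        ... | inj₁ Mx  = Mx
        ... | inj₂ ¬Mx = ⊥-elim (rest-∌ (∖⁺ Yx ¬Mx))
        outer : ∃[ x ] ∁ Y ∋ x × x ∈ V G
        outer with link⇒edge {⟪ z ⟫} {∁ Y} anchor
        ... | g , g∈ , p , q , j , _ , ∁q with j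
        ...   | inj₁ eq = q , ∁q , subst (_∈ V G) (cong proj₂ eq) (proj₂ (ends∈V G g∈))
        ...   | inj₂ eq = q , ∁q , subst (_∈ V G) (cong proj₁ eq) (proj₁ (ends∈V G g∈))
        cut-Y : 3 ≤ zX + mX
        cut-Y with outer
        ... | x , ∁x , x∈ = begin
          3                                      ≤⟨ 3≤cut connected Y (Y⊆V Yz) x∈ Yz (∁⁻ ∁x) ⟩
          link Y (∁ Y)                           ≡⟨ link-splitˡ (∁ Y) z⊑Y ⟩
          zX + link (Y ∖ ⟪ z ⟫) (∁ Y)            ≤⟨ +-monoʳ-≤ zX (link-mono Y⊑M id) ⟩
          zX + mX                                ∎
          where open ≤-Reasoning
        total : mX < 2 → 6 ≤ 5
        total (s≤s mX≤1) = begin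
          6                           ≤⟨ +-mono-≤ cut-Y cut-M ⟩
          zX + mX + (mX + zM)         ≤⟨ +-mono-≤ (+-monoʳ-≤ zX mX≤1) (+-monoˡ-≤ zM mX≤1) ⟩
          zX + 1 + (1 + zM)           ≡⟨ solve 2 (λ a b → a :+ con 1 :+ (con 1 :+ b) := con 2 :+ (a :+ b)) refl zX zM ⟩
          2 + (zX + zM)               ≤⟨ +-monoʳ-≤ 2 (+-monoʳ-≤ zX (m≤m+n zM zR)) ⟩
          2 + (zX + (zM + zR))        ≤⟨ +-monoʳ-≤ 2 deg-z ⟩
          5                           ∎
          where
          open ≤-Reasoning
          open +-*-Solver

    module _ (ear : Ear) where

      private
        A K X : VSet n
        A = W ear
        K = Y ∖ A
        X = ∁ Y

      Smaller : Set
      Smaller = ∃[ ear′ ] size (W ear′) < size A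

      Branch : Fin n → Fin n → Set
      Branch w v = ∃[ C ] C ⊑ A ∖ ⟪ w ⟫ × C ∋ v × Closed-in (A ∖ ⟪ w ⟫) C × link C X ≤ 1 × link C ⟪ w ⟫ ≤ 1

      -- `C` is the component of `v` in the ear without `w`. With two edges to `X` it is a smaller
      -- ear, whose complement in `Y` hangs together through `K` and `w`. Otherwise some edge from
      -- the ear to `X` starts outside `C`, so `w` has, besides its edge to `K`, an edge to `X` or
      -- to another component; at most one edge remains for `C`.
      branch : ∀ {w v} → A ∋ w → 1 ≤ link ⟪ w ⟫ K → A ∋ v → v ≢ w → Smaller ⊎ Branch w v
      branch {w} {v} Aw adj Av v≢w with component (A ∖ ⟪ w ⟫) (∖⁺ Av (∉⟪⟫ v≢w))
      ... | C , C⊑ , Cv , closed , connC with 2 ≤? link C X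
      ...   | yes 2≤ = inj₁ (smaller , size-⊏ (∖⊑ ∘ C⊑) Aw (¬∋⇒∌ λ Cw → ∋∌⇒⊥ ⟪⟫⁺ (∖-∌ (C⊑ Cw))))
        where
        K∪w⊑Y : K ∪ᵛ ⟪ w ⟫ ⊑ Y
        K∪w⊑Y = [ ∖⊑ , (λ x∈ → subst (Y ∋_) (sym (⟪⟫⁻ x∈)) (W⊑Y ear Aw)) ]′ ∘ ∪⁻
        C⊑Y∖ : C ⊑ Y ∖ (K ∪ᵛ ⟪ w ⟫)
        C⊑Y∖ Cx = ∖⁺ (W⊑Y ear (∖⊑ (C⊑ Cx))) (∪-∌⁺ (∖-∌⁺ (∖⊑ (C⊑ Cx))) (∖-∌ (C⊑ Cx)))
        closed′ : Closed-in (Y ∖ (K ∪ᵛ ⟪ w ⟫)) C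
        closed′ g∈ j Cp q∈ with ∪-∌⁻ (∖-∌ q∈)
        ... | ¬Kq , ¬wq = closed g∈ j Cp (∖⁺ (∖-∌⁻ (∖⊑ q∈) ¬Kq) ¬wq)
        conn-K∪w : ConnG (K ∪ᵛ ⟪ w ⟫)
        conn-K∪w with link⇒edge {⟪ w ⟫} {K} adj
        ... | g , g∈ , p , q , j , wp , Kq with ⟪⟫⁻ wp
        ...   | refl = conn-add (conn-K ear) Kq g∈ (joins-sym j)
        smaller : Ear
        smaller = record
          { W = C ; W⊑Y = W⊑Y ear ∘ ∖⊑ ∘ C⊑ ; z∉W = ∌-⊑ (∖⊑ ∘ C⊑) (z∉W ear) ; conn-W = connC
          ; conn-K = peel connY conn-K∪w (∪⁺ʳ ⟪⟫⁺) K∪w⊑Y C⊑Y∖ closed′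
          ; feet = 2≤ }
      ...   | no ¬2≤ = inj₂ (C , C⊑ , Cv , closed , CX≤1 , Cw≤1)
        where
        D : VSet n
        D = A ∖ ⟪ w ⟫ ∖ C
        CX≤1 : link C X ≤ 1
        CX≤1 = ≤-pred (≰⇒> ¬2≤)
        w⊑A : ⟪ w ⟫ ⊑ A
        w⊑A x∈ = subst (A ∋_) (sym (⟪⟫⁻ x∈)) Aw
        wX = link ⟪ w ⟫ X
        wC = link ⟪ w ⟫ C
        wD = link ⟪ w ⟫ D
        deg-w : wC + (wX + wD) ≤ 2
        deg-w = +-cancelʳ-≤ 1 (wC + (wX + wD)) 2 (begin
          wC + (wX + wD) + 1                          ≤⟨ +-monoʳ-≤ (wC + (wX + wD)) adj ⟩
          wC + (wX + wD) + link ⟪ w ⟫ K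
            ≡⟨ solve 4 (λ c x d k → c :+ (x :+ d) :+ k := c :+ d :+ k :+ x) refl wC wX wD (link ⟪ w ⟫ K) ⟩
          wC + wD + link ⟪ w ⟫ K + wX
            ≡⟨ cong (λ a → a + link ⟪ w ⟫ K + wX) (sym (link-splitʳ ⟪ w ⟫ C⊑)) ⟩
          link ⟪ w ⟫ (A ∖ ⟪ w ⟫) + link ⟪ w ⟫ K + wX  ≤⟨ +-monoˡ-≤ wX (+-monoˡ-≤ (link ⟪ w ⟫ K) (link-mono id ∖⊑)) ⟩
          link ⟪ w ⟫ A + link ⟪ w ⟫ K + wX            ≡⟨ cong (_+ wX) (sym (link-splitʳ ⟪ w ⟫ (W⊑Y ear))) ⟩
          link ⟪ w ⟫ Y + wX                           ≡⟨ sym (link-splitʳ ⟪ w ⟫ (λ _ → full-∋)) ⟩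
          link ⟪ w ⟫ full                             ≡⟨ degree≡3 (Y⊆V (W⊑Y ear Aw)) ⟩
          3                                           ∎)
          where
          open ≤-Reasoning
          open +-*-Solver
        other-foot : 1 ≤ wX + link D X
        other-foot = +-cancelʳ-≤ 1 1 (wX + link D X) (begin
          2                                ≤⟨ feet ear ⟩
          link A X                         ≡⟨ link-splitˡ X w⊑A ⟩
          wX + link (A ∖ ⟪ w ⟫) X          ≡⟨ cong (wX +_) (link-splitˡ X C⊑) ⟩
          wX + (link C X + link D X)       ≤⟨ +-monoʳ-≤ wX (+-monoˡ-≤ (link D X) CX≤1) ⟩
          wX + (1 + link D X)              ≡⟨ solve 2 (λ a b → a :+ (con 1 :+ b) := a :+ b :+ con 1) refl wX (link D X) ⟩
          wX + link D X + 1                ∎)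
          where
          open ≤-Reasoning
          open +-*-Solver
        D-attached : ∀ {d} → D ∋ d → 1 ≤ wD
        D-attached Dd with conn-W ear D (∖⊑ (∖⊑ Dd)) Aw Dd (∌-⊑ ∖⊑ (∖-∌⁺ ⟪⟫⁺))
        ... | g , p , q , g∈ , j , Ap , Aq , Dp , ¬Dq with member? C q | q ≟ w
        ...   | _        | yes refl = edge⇒link g∈ (joins-sym j) ⟪⟫⁺ Dp
        ...   | inj₁ Cq  | no _     = ⊥-elim (∋∌⇒⊥ (closed g∈ (joins-sym j) Cq (∖⊑ Dp)) (∖-∌ Dp))
        ...   | inj₂ ¬Cq | no q≢w   = ⊥-elim (∋∌⇒⊥ (∖⁺ (∖⁺ Aq (∉⟪⟫ q≢w)) ¬Cq) ¬Dq)
        1≤wX+wD : 1 ≤ wX + wD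
        1≤wX+wD with 1 ≤? link D X
        ... | yes 1≤ = let _ , _ , _ , _ , _ , Dd , _ = link⇒edge {D} {X} 1≤ in ≤-trans (D-attached Dd) (m≤n+m wD wX)
        ... | no ¬1≤ = ≤-trans (subst (λ k → 1 ≤ wX + k) (n<1⇒n≡0 (≰⇒> ¬1≤)) other-foot)
                               (+-monoʳ-≤ wX z≤n)
        Cw≤1 : link C ⟪ w ⟫ ≤ 1
        Cw≤1 = subst (_≤ 1) (link-sym ⟪ w ⟫ C) (+-cancelʳ-≤ 1 wC 1 (≤-trans (+-monoʳ-≤ wC 1≤wX+wD) deg-w))

      -- Among the edges that avoid `K`, passing from `S` to `S ∩ᵛ C` can add only those to `w`,
      -- hence at most one. It is paid for by an edge that leaves `S` from the discarded part `J`,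
      -- towards `X` or the rest of the ear.
      narrow : ∀ {w v S} → A ∋ w → S ∋ w → S ∋ v → S ⊑ A → ((C , _) : Branch w v) →
               link S X + link S (A ∖ S) ≤ 2 → link (S ∩ᵛ C) X + link (S ∩ᵛ C) (A ∖ (S ∩ᵛ C)) ≤ 2
      narrow {w} {v} {S} Aw Sw Sv S⊑A (C , C⊑ , Cv , closed , CX≤1 , Cw≤1) S≤2 = begin
        link I X + link I (A ∖ I)
          ≡⟨ cong (link I X +_) (link-splitʳ I C∖S⊑) ⟩
        link I X + (link I (C ∖ S) + link I (A ∖ I ∖ (C ∖ S)))
          ≡⟨ cong (λ k → link I X + (link I (C ∖ S) + k)) (link-splitʳ I w⊑) ⟩
        link I X + (link I (C ∖ S) + (link I ⟪ w ⟫ + link I (A ∖ I ∖ (C ∖ S) ∖ ⟪ w ⟫)))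
          ≡⟨ cong (λ k → link I X + (link I (C ∖ S) + (link I ⟪ w ⟫ + k))) no-more ⟩
        link I X + (link I (C ∖ S) + (link I ⟪ w ⟫ + 0))
          ≤⟨ +-monoʳ-≤ (link I X) (+-monoʳ-≤ (link I (C ∖ S)) (+-monoˡ-≤ 0 (≤-trans (≤-trans (link-mono (proj₂ ∘ ∩⁻) id) Cw≤1) exit))) ⟩
        link I X + (link I (C ∖ S) + (link J X + link J (A ∖ S) + 0))
          ≡⟨ solve 4 (λ a b c d → a :+ (b :+ (c :+ d :+ con 0)) := a :+ c :+ (b :+ d)) refl (link I X) (link I (C ∖ S)) (link J X) (link J (A ∖ S)) ⟩
        link I X + link J X + (link I (C ∖ S) + link J (A ∖ S))
          ≤⟨ +-monoʳ-≤ (link I X + link J X) (+-monoˡ-≤ (link J (A ∖ S)) (link-mono id λ x∈ → ∖⁺ (∖⊑ (C⊑ (∖⊑ x∈))) (∖-∌ x∈))) ⟩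
        link I X + link J X + (link I (A ∖ S) + link J (A ∖ S))
          ≡⟨ sym (cong₂ _+_ (link-splitˡ X I⊑S) (link-splitˡ (A ∖ S) I⊑S)) ⟩
        link S X + link S (A ∖ S)
          ≤⟨ S≤2 ⟩
        2 ∎
        where
        open ≤-Reasoning
        open +-*-Solver
        I J : VSet n
        I = S ∩ᵛ C
        J = S ∖ I
        I⊑S : I ⊑ S
        I⊑S = proj₁ ∘ ∩⁻
        ¬Cw : C ∌ w
        ¬Cw = ¬∋⇒∌ λ Cw → ∋∌⇒⊥ ⟪⟫⁺ (∖-∌ (C⊑ Cw))
        C∖S⊑ : C ∖ S ⊑ A ∖ I
        C∖S⊑ x∈ = ∖⁺ (∖⊑ (C⊑ (∖⊑ x∈))) (∌-⊑ I⊑S (∖-∌ x∈))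
        w⊑ : ⟪ w ⟫ ⊑ A ∖ I ∖ (C ∖ S)
        w⊑ x∈ with ⟪⟫⁻ x∈
        ... | refl = ∖⁺ (∖⁺ Aw (∌-⊑ (proj₂ ∘ ∩⁻) ¬Cw)) (∌-⊑ ∖⊑ ¬Cw)
        no-more : link I (A ∖ I ∖ (C ∖ S) ∖ ⟪ w ⟫) ≡ 0
        no-more = no-edge⇒link≡0 λ {g} {p} {q} g∈ j Ip q∈ →
          let q∉C∖S = ∖-∌ (∖⊑ q∈)
              q∈A∖I = ∖⊑ (∖⊑ q∈)
              Cq    = closed g∈ j (proj₂ (∩⁻ Ip)) (∖⁺ (∖⊑ q∈A∖I) (∖-∌ q∈))
          in  ∋∌⇒⊥ (∩⁺ (∖-∌⁻ Cq q∉C∖S) Cq) (∖-∌ q∈A∖I)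
        -- Since `C` has at most one edge to `X`, some vertex `p` of the ear outside `C` has one
        -- too. If `p` is not in `S`, connectivity of the ear gives an edge leaving `S ∪ᵛ C`; it
        -- cannot start in `C`, because inside the ear `C` is left only towards `w`, which is in
        -- `S`.
        exit : 1 ≤ link J X + link J (A ∖ S)
        exit with 1 ≤? link (A ∖ C) X
        ... | no ¬1≤ = ⊥-elim (1+n≰n (begin
          2                           ≤⟨ feet ear ⟩
          link A X                    ≡⟨ link-splitˡ X (∖⊑ ∘ C⊑) ⟩
          link C X + link (A ∖ C) X   ≤⟨ +-mono-≤ CX≤1 (≤-pred (≰⇒> ¬1≤)) ⟩
          1                           ∎))
        ... | yes 1≤ with link⇒edge {A ∖ C} {X} 1≤
        ... | g , g∈ , p , q , j , ACp , Xq with member? S p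
        ...   | inj₁ Sp = ≤-trans (edge⇒link g∈ j (∖⁺ Sp (∌-⊑ (proj₂ ∘ ∩⁻) (∖-∌ ACp))) Xq) (m≤m+n _ _)
        ...   | inj₂ ¬Sp with conn-W ear (S ∪ᵛ C) Aw (∖⊑ ACp) (∪⁺ˡ Sw) (∪-∌⁺ ¬Sp (∖-∌ ACp))
        ...     | h , s , t , h∈ , k , As , At , SCs , ¬SCt with ∪-∌⁻ ¬SCt | member? C s
        ...       | ¬St , ¬Ct | inj₁ Cs = ⊥-elim (∋∌⇒⊥ (closed h∈ k Cs (∖⁺ At (∉⟪⟫ λ { refl → ∋∌⇒⊥ Sw ¬St }))) ¬Ct)
        ...       | ¬St , ¬Ct | inj₂ ¬Cs with ∪⁻ SCs
        ...         | inj₂ Cs = ⊥-elim (∋∌⇒⊥ Cs ¬Cs)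
        ...         | inj₁ Ss = ≤-trans (edge⇒link h∈ k (∖⁺ Ss (∌-⊑ (proj₂ ∘ ∩⁻) ¬Cs)) (∖⁺ At ¬St)) (m≤n+m _ _)

      -- S is the part of the ear that can still contain a vertex without neighbours in K.
      -- It has at most two edges that avoid K, hence by 3-edge-connectivity a vertex w
      -- with a neighbour in K; one passes to the branch of v at w.
      search : ∀ k S {v} → size S ≤ k → S ⊑ A → S ∋ v → link S X + link S (A ∖ S) ≤ 2 →
               Smaller ⊎ 1 ≤ link ⟪ v ⟫ K
      search k S {v} ≤k S⊑A Sv S≤2 with link⇒edge {S} {K} S-adj
        where
        S⊑Y : S ⊑ Y
        S⊑Y = W⊑Y ear ∘ S⊑A
        S-adj : 1 ≤ link S K
        S-adj = +-cancelˡ-≤ 2 1 (link S K) (begin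
          3                                          ≤⟨ 3≤cut connected S (Y⊆V (S⊑Y Sv)) (Y⊆V Yz) Sv (∌-⊑ S⊑A (z∉W ear)) ⟩
          link S (∁ S)                               ≡⟨ link-splitʳ S (λ x∈ → ∁⁺ (∌-⊑ S⊑Y (∁⁻ x∈))) ⟩
          link S X + link S (∁ S ∖ X)                ≡⟨ cong (link S X +_) (link-splitʳ S A∖S⊑) ⟩
          link S X + (link S (A ∖ S) + link S (∁ S ∖ X ∖ (A ∖ S)))
            ≤⟨ +-monoʳ-≤ (link S X) (+-monoʳ-≤ (link S (A ∖ S)) (link-mono id ⊑K)) ⟩
          link S X + (link S (A ∖ S) + link S K)     ≡⟨ sym (+-assoc (link S X) _ _) ⟩
          link S X + link S (A ∖ S) + link S K       ≤⟨ +-monoˡ-≤ (link S K) S≤2 ⟩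
          2 + link S K                               ∎)
          where
          open ≤-Reasoning
          A∖S⊑ : A ∖ S ⊑ ∁ S ∖ X
          A∖S⊑ x∈ = ∖⁺ (∁⁺ (∖-∌ x∈)) (∁-∌⁺ (W⊑Y ear (∖⊑ x∈)))
          ⊑K : ∁ S ∖ X ∖ (A ∖ S) ⊑ K
          ⊑K x∈ = ∖⁺ (∁-∌⁻ (∖-∌ (∖⊑ x∈))) (¬∋⇒∌ λ Ax → ∋∌⇒⊥ (∖⁺ Ax (∁⁻ (∖⊑ (∖⊑ x∈)))) (∖-∌ x∈))
      ... | g , g∈ , w , q , j , Sw , Kq with v ≟ w
      ...   | yes refl = inj₂ (edge⇒link g∈ j ⟪⟫⁺ Kq)
      ...   | no v≢w with branch (S⊑A Sw) (edge⇒link g∈ j ⟪⟫⁺ Kq) (S⊑A Sv) v≢w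
      ...     | inj₁ smaller = inj₁ smaller
      ...     | inj₂ b@(C , C⊑ , Cv , _)
        with ≤-trans (size-⊏ (proj₁ ∘ ∩⁻) Sw (∌-⊑ (proj₂ ∘ ∩⁻) (¬∋⇒∌ λ Cw → ∋∌⇒⊥ ⟪⟫⁺ (∖-∌ (C⊑ Cw))))) ≤k
      ...       | s≤s ≤k′ = search _ (S ∩ᵛ C) ≤k′ (S⊑A ∘ proj₁ ∘ ∩⁻) (∩⁺ Sv Cv) (narrow (S⊑A Sw) Sw Sv S⊑A b S≤2)

      -- Connectivity of `Y` provides a vertex `w` of the ear with a neighbour in `K`. The branch of
      -- `v` at `w` has at most one edge to `X` and at most one to `w`, the only other vertex of the
      -- ear that it can reach; this is the bound 2 with which `search` starts.
      attached-or-smaller : ∀ {v} → A ∋ v → Smaller ⊎ 1 ≤ link ⟪ v ⟫ K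
      attached-or-smaller {v} Av with conn⁻ 
        where
        conn⁻ : Crosses (_∈ E G) (Y ∋_) A
        conn⁻ = connY A (W⊑Y ear Av) Yz Av (z∉W ear)
      ... | g , w , q , g∈ , j , Yw , Yq , Aw , ¬Aq with v ≟ w
      ...   | yes refl = inj₂ (edge⇒link g∈ j ⟪⟫⁺ (∖⁺ Yq ¬Aq))
      ...   | no v≢w with branch Aw (edge⇒link g∈ j ⟪⟫⁺ (∖⁺ Yq ¬Aq)) Av v≢w
      ...     | inj₁ smaller = inj₁ smaller
      ...     | inj₂ (C , C⊑ , Cv , closed , CX≤1 , Cw≤1) =
        search _ C ≤-refl (∖⊑ ∘ C⊑) Cv (+-mono-≤ CX≤1 (begin
          link C (A ∖ C)                                 ≡⟨ link-splitʳ C w⊑ ⟩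
          link C ⟪ w ⟫ + link C (A ∖ C ∖ ⟪ w ⟫)          ≡⟨ cong (link C ⟪ w ⟫ +_) none ⟩
          link C ⟪ w ⟫ + 0                               ≡⟨ +-identityʳ _ ⟩
          link C ⟪ w ⟫                                   ≤⟨ Cw≤1 ⟩
          1                                              ∎))
        where
        open ≤-Reasoning
        w⊑ : ⟪ w ⟫ ⊑ A ∖ C
        w⊑ x∈ with ⟪⟫⁻ x∈
        ... | refl = ∖⁺ Aw (¬∋⇒∌ λ Cw → ∋∌⇒⊥ ⟪⟫⁺ (∖-∌ (C⊑ Cw)))
        none : link C (A ∖ C ∖ ⟪ w ⟫) ≡ 0
        none = no-edge⇒link≡0 λ g∈′ j′ Cp q∈ →
          ∋∌⇒⊥ (closed g∈′ j′ Cp (∖⁺ (∖⊑ (∖⊑ q∈)) (∖-∌ q∈))) (∖-∌ (∖⊑ q∈))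

    Attached : Ear → Set
    Attached ear = ∀ {v} → W ear ∋ v → 1 ≤ link ⟪ v ⟫ (Y ∖ W ear)

    -- Minimality takes the form of a descent: a vertex of the ear without a neighbour in the rest
    -- of `Y` always yields a smaller ear.
    minimal-ear : ∀ k (ear : Ear) → size (W ear) ≤ k → ∃ Attached
    minimal-ear k ear ≤k with any? (λ v → (W ear ∋? v) ×-dec ¬? (1 ≤? link ⟪ v ⟫ (Y ∖ W ear)))
    ... | no all-attached = ear , λ {v} Wv → decide v Wv
      where
      decide : ∀ v → W ear ∋ v → 1 ≤ link ⟪ v ⟫ (Y ∖ W ear)
      decide v Wv with 1 ≤? link ⟪ v ⟫ (Y ∖ W ear)
      ... | yes 1≤ = 1≤
      ... | no ¬1≤ = ⊥-elim (all-attached (v , Wv , ¬1≤))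
    ... | yes (v , Wv , ¬1≤) with attached-or-smaller ear Wv
    ...   | inj₂ 1≤ = ⊥-elim (¬1≤ 1≤)
    ...   | inj₁ (ear′ , <k) with ≤-trans <k ≤k
    ...     | s≤s ≤k′ = minimal-ear _ ear′ ≤k′

    attached-ear : ∀ {y} → Y ∋ y → y ≢ z → ∃ Attached
    attached-ear Yy y≢z = minimal-ear _ (initial Yy y≢z) ≤-refl

-- Closure and growth

joins∈V : ∀ {n m} {ends : Ends n m} (F : Graph ends) {g p q} → g ∈ E F → Joins ends g p q → p ∈ V F × q ∈ V F
joins∈V {ends = ends} F {g} g∈ j with Joining.joins-pair ends j (Joining.joins-ends ends g)
... | inj₁ (refl , refl) = ends∈V F g∈
... | inj₂ (refl , refl) = proj₂ (ends∈V F g∈) , proj₁ (ends∈V F g∈)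

module Closure {n m : ℕ} {ends : Ends n m} (H : Graph ends) where

  open Joining ends

  -- The consequence of 2-closedness that is used: a cycle consisting of e, at most one
  -- further edge f outside R, and edges of R, forces e ∈ R.
  record Closed (R : Subset m) : Set where
    field
      R⊆E    : R ⊆ E H
      absorb : ∀ {e f u v} → e ∈ E H → f ∈ E H → Joins ends e u v →
               Star (Via λ g → g ≢ e × (g ∈ R ⊎ g ≡ f)) u v → e ∈ R

  open Closed public

  Spans : Subset m → (Fin n → Set) → Set
  Spans R P = ∀ {u v} → P u → P v → Star (Via (_∈ R)) u v

  star-avoiding : ∀ {R e f u v} → e ∉ R → Star (Via (_∈ R)) u v → Star (Via λ g → g ≢ e × (g ∈ R ⊎ g ≡ f)) u v
  star-avoiding e∉ = Star.map λ { (g , g∈ , j) → g , ((λ { refl → e∉ g∈ }) , inj₁ g∈) , j }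

  ConnOff : Subset m → Set
  ConnOff B = Conn (λ g → g ∈ E H × g ∉ B) (_∈ V H)

  -- Quantifies over all closed sets, so that the closure itself never has to be constructed.
  Generates : Subset m → Set
  Generates B = ∀ {R} → Closed R → B ⊆ R → E H ⊆ R

  span⇒E⊆ : ∀ {R} → Closed R → Spans R (_∈ V H) → E H ⊆ R
  span⇒E⊆ {R} closed spans {e} e∈ with e ∈? R
  ... | yes e∈R = e∈R
  -- No second edge outside `R` occurs on this cycle; `e` itself fills the place of `f`.
  ... | no  e∉R = absorb closed e∈ e∈ (joins-ends e)
    (star-avoiding e∉R (spans (proj₁ (ends∈V H e∈)) (proj₂ (ends∈V H e∈))))

  -- Walks in `R` on both sides close `g` and `h` up to a cycle with at most two edges outside `R`,
  -- fewer than the three that a 2-closed set demands. This is what the two feet of an ear are for.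
  two-links : ∀ {R P Q g h a w b x} → Closed R → Spans R P → Spans R Q → g ≢ h → g ∈ E H → h ∈ E H →
              Joins ends g a w → Joins ends h b x → P a → Q w → P b → Q x → g ∈ R
  two-links {R} {g = g} closed spanP spanQ g≢h g∈ h∈ jg jh Pa Qw Pb Qx with g ∈? R
  ... | yes g∈R = g∈R
  ... | no  g∉R = absorb closed g∈ h∈ jg
    (star-avoiding g∉R (spanP Pa Pb) ◅◅ (_ , (≢-sym g≢h , inj₂ refl) , jh) ◅ star-avoiding g∉R (spanQ Qx Qw))

  spans-∪ : ∀ {R P Q g a w} → Spans R P → Spans R Q → g ∈ R → Joins ends g a w → P a → Q w →
            Spans R (λ x → P x ⊎ Q x)
  spans-∪ spanP spanQ g∈ j Pa Qw (inj₁ Pu) (inj₁ Pv) = spanP Pu Pv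
  spans-∪ spanP spanQ g∈ j Pa Qw (inj₁ Pu) (inj₂ Qv) = spanP Pu Pa ◅◅ (_ , g∈ , j) ◅ spanQ Qw Qv
  spans-∪ spanP spanQ g∈ j Pa Qw (inj₂ Qu) (inj₁ Pv) = spanQ Qu Qw ◅◅ (_ , g∈ , joins-sym j) ◅ spanP Pa Pv
  spans-∪ spanP spanQ g∈ j Pa Qw (inj₂ Qu) (inj₂ Qv) = spanQ Qu Qv

-- Invariant and iteration of the growth

module Growth {n m : ℕ} {ends : Ends n m} (G : Graph ends) (connected : EdgeConnected 3 G) (cubic : Cubic G)
              (H : Graph ends) (H⊆G : H ⊆ᴳ G)
              (induced : ∀ {g p q} → g ∈ E G → Joins ends g p q → p ∈ V H → q ∈ V H → g ∈ E H)
              where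

  open Ears G connected cubic
  open Closure H public

  abstract

    inside : VSet n → Subset m
    inside A = tabulate λ g → does ((g ∈? E G) ×-dec (A ∋? proj₁ (ends g)) ×-dec (A ∋? proj₂ (ends g)))

    inside⁺ : ∀ {A g p q} → g ∈ E G → Joins ends g p q → A ∋ p → A ∋ q → g ∈ inside A
    inside⁺ {A} {g} g∈ j Ap Aq =
      ∈-tabulate⁺ (dec-true ((g ∈? E G) ×-dec (A ∋? proj₁ (ends g)) ×-dec (A ∋? proj₂ (ends g))) (g∈ , both))
      where
      both : A ∋ proj₁ (ends g) × A ∋ proj₂ (ends g)
      both with joins-pair j (joins-ends g)
      ... | inj₁ (refl , refl) = Ap , Aq
      ... | inj₂ (refl , refl) = Aq , Ap

    inside⁻ : ∀ {A g} → g ∈ inside A → g ∈ E G × (∀ {p q} → Joins ends g p q → A ∋ p × A ∋ q)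
    inside⁻ {A} {g} g∈ with does-sound ((g ∈? E G) ×-dec (A ∋? proj₁ (ends g)) ×-dec (A ∋? proj₂ (ends g)))
      (∈-tabulate⁻ {f = λ h → does ((h ∈? E G) ×-dec (A ∋? proj₁ (ends h)) ×-dec (A ∋? proj₂ (ends h)))} g∈)
    ... | g∈E , Au , Av = g∈E , both
      where
      both : ∀ {p q} → Joins ends g p q → A ∋ p × A ∋ q
      both j with joins-pair j (joins-ends g)
      ... | inj₁ (refl , refl) = Au , Av
      ... | inj₂ (refl , refl) = Av , Au

  inside-spans : ∀ {R A} → ConnG A → inside A ⊆ R → Spans R (A ∋_)
  inside-spans {R} {A} conn inside⊆R = conn⇒star conn-R
    where
    conn-R : Conn (_∈ R) (A ∋_)
    conn-R U Ax Ay Ux Uy with conn U Ax Ay Ux Uy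
    ... | g , p , q , g∈ , j , Ap , Aq , Up , Uq = g , p , q , inside⊆R (inside⁺ g∈ j Ap Aq) , j , Ap , Aq , Up , Uq

  -- An edge inside W that is used for connectivity can be bypassed through K = Y ∖ W,
  -- which is connected and adjacent to every vertex of W.
  connOff-attached : ∀ {Y W B} → (∀ {x} → Y ∋ x → x ∈ V H) → W ⊑ Y →
    (∀ {g p q} → g ∈ B → Joins ends g p q → Y ∋ p → Y ∋ q → ⊥) →
    ConnG (Y ∖ W) → (∀ {v} → W ∋ v → 1 ≤ link ⟪ v ⟫ (Y ∖ W)) →
    ConnOff B → ConnOff (B ∪ inside W)
  connOff-attached {Y} {W} {B} Y⊆H W⊑Y B-outside conn-K attached conn U x∈ y∈ Ux Uy with conn U x∈ y∈ Ux Uy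
  ... | g , p , q , (g∈ , g∉B) , j , p∈ , q∈ , Up , Uq with g ∈? inside W
  ...   | no g∉W = g , p , q , (g∈ , [ g∉B , g∉W ]′ ∘ x∈p∪q⁻ B (inside W)) , j , p∈ , q∈ , Up , Uq
  ...   | yes g∈W = bypass (to-K (proj₁ (proj₂ (inside⁻ g∈W) j))) (to-K (proj₂ (proj₂ (inside⁻ g∈W) j)))
    where
    K = Y ∖ W
    F : Fin m → Set
    F h = h ∈ E H × h ∉ B ∪ inside W
    free : ∀ {h s t} → h ∈ E G → Joins ends h s t → Y ∋ s → K ∋ t → F h
    free h∈ k Ys Kt = induced h∈ k (Y⊆H Ys) (Y⊆H (∖⊑ Kt)) ,
      [ (λ h∈B → B-outside h∈B k Ys (∖⊑ Kt)) , (λ h∈W → ∋∌⇒⊥ (proj₂ (proj₂ (inside⁻ h∈W) k)) (∖-∌ Kt)) ]′ ∘ x∈p∪q⁻ B (inside W)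
    to-K : ∀ {v} → W ∋ v → ∃[ h ] ∃[ t ] F h × Joins ends h v t × K ∋ t
    to-K {v} Wv with link⇒edge (attached Wv)
    ... | h , h∈ , s , t , k , s∈ , Kt with ⟪⟫⁻ s∈
    ...   | refl = h , t , free h∈ k (W⊑Y Wv) Kt , k , Kt
    bypass : (∃[ h ] ∃[ t ] F h × Joins ends h p t × K ∋ t) → (∃[ h ] ∃[ t ] F h × Joins ends h q t × K ∋ t) →
             Crosses F (_∈ V H) U
    bypass (h , s , Fh , k , Ks) (h′ , t , Fh′ , k′ , Kt) with member? U s | member? U t
    ... | inj₂ ¬Us | _        = h , p , s , Fh , k , p∈ , Y⊆H (∖⊑ Ks) , Up , ¬Us
    ... | inj₁ _   | inj₁ Ut  = h′ , t , q , Fh′ , joins-sym k′ , Y⊆H (∖⊑ Kt) , q∈ , Ut , Uq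
    ... | inj₁ Us  | inj₂ ¬Ut with conn-K U Ks Kt Us ¬Ut
    ...   | i , a , b , i∈ , l , Ka , Kb , Ua , Ub = i , a , b , free i∈ l (∖⊑ Ka) Kb , l , Y⊆H (∖⊑ Ka) , Y⊆H (∖⊑ Kb) , Ua , Ub

  module _ {c : Fin m} {z x : Fin n} (c∈ : c ∈ E G) (c-joins : Joins ends c z x) where

    -- Of the edges between `Y` and its complement, `H` may lack only `c`, as `boundary` records.
    -- `B-outside` keeps all edges inside `Y` available for connectivity off `B`. Phrased for every
    -- closed set above `B`, `spans` keeps track of the closure.
    record State (Y : VSet n) (B : Subset m) : Set where
      field
        Yz        : Y ∋ z
        ¬Yx       : Y ∌ x
        Y⊆H       : ∀ {y} → Y ∋ y → y ∈ V H
        connY     : ConnG Y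
        boundary  : ∀ {g p q} → g ∈ E G → g ≢ c → Joins ends g p q → Y ∌ p → Y ∋ q → g ∈ E H
        B⊆E       : B ⊆ E H
        B-outside : ∀ {g p q} → g ∈ B → Joins ends g p q → Y ∋ p → Y ∋ q → ⊥
        connOff   : ConnOff B
        spans     : ∀ {R} → Closed R → B ⊆ R → Spans R (λ y → y ∈ V H × Y ∌ y)

      anchor : 1 ≤ link ⟪ z ⟫ (∁ Y)
      anchor = edge⇒link c∈ c-joins ⟪⟫⁺ (∁⁺ ¬Yx)

      ear : ∀ {y} → Y ∋ y → y ≢ z → ∃ (Region.Attached Y (proj₁ H⊆G ∘ Y⊆H) z Yz connY anchor)
      ear = Region.attached-ear Y (proj₁ H⊆G ∘ Y⊆H) z Yz connY anchor

    open State

    inside⊆E : ∀ {W} → (∀ {y} → W ∋ y → y ∈ V H) → inside W ⊆ E H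
    inside⊆E W⊆H {g} g∈ with inside⁻ g∈
    ... | g∈E , both with both (joins-ends g)
    ...   | Wp , Wq = induced g∈E (joins-ends g) (W⊆H Wp) (W⊆H Wq)

    -- The ear lies in `Y` and avoids `z`, while `c` joins `z` to a vertex outside `Y`. So `c` has
    -- no end in the ear, and `boundary` places the feet in `H`.
    foot : ∀ {Y B} (s : State Y B) {W g p q} → W ⊑ Y → W ∌ z → g ∈ E G → Joins ends g p q → W ∋ p → ∁ Y ∋ q →
           g ∈ E H × q ∈ V H × Y ∌ q
    foot {Y} s {W} {g} {p} {q} W⊑Y z∉W g∈ j Wp ∁q = g∈H , proj₂ (joins∈V H g∈H j) , ∁⁻ ∁q
      where
      g≢c : g ≢ c
      g≢c refl with joins-pair j c-joins
      ... | inj₁ (refl , _) = ∋∌⇒⊥ Wp z∉W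
      ... | inj₂ (refl , _) = ∋∌⇒⊥ (W⊑Y Wp) (¬Yx s)
      g∈H : g ∈ E H
      g∈H = boundary s g∈ g≢c (joins-sym j) (∁⁻ ∁q) (W⊑Y Wp)

    boundary-shrink : ∀ {Y B W} → State Y B →
      ∀ {g p q} → g ∈ E G → g ≢ c → Joins ends g p q → Y ∖ W ∌ p → Y ∖ W ∋ q → g ∈ E H
    boundary-shrink {Y} s {p = p} g∈ g≢c j ¬Kp Kq with member? Y p
    ... | inj₁ Yp  = induced g∈ j (Y⊆H s Yp) (Y⊆H s (∖⊑ Kq))
    ... | inj₂ ¬Yp = boundary s g∈ g≢c j ¬Yp (∖⊑ Kq)

    spans-shrink : ∀ {Y B W} → State Y B → W ⊑ Y → W ∌ z → ConnG W → 2 ≤ link W (∁ Y) →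
      ∀ {R} → Closed R → B ∪ inside W ⊆ R → Spans R (λ y → y ∈ V H × Y ∖ W ∌ y)
    spans-shrink {Y} {B} {W} s W⊑Y z∉W conn-W feet {R} closed B∪W⊆R {u} {v} u∈ v∈ =
      let g , h , g≢h , (g∈ , p , q , j , Wp , ∁q) , (h∈ , p′ , q′ , j′ , Wp′ , ∁q′) =
            link⇒two-edges {W} {∁ Y} (λ Wx ∁x → ∋∌⇒⊥ (W⊑Y Wx) (∁⁻ ∁x)) feet
          g∈H , q∈ = foot s W⊑Y z∉W g∈ j Wp ∁q
          h∈H , q′∈ = foot s W⊑Y z∉W h∈ j′ Wp′ ∁q′
          g∈R = two-links {P = Old} {Q = W ∋_} closed spanO spanW g≢h g∈H h∈H (joins-sym j) (joins-sym j′) q∈ Wp q′∈ Wp′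
      in  spans-∪ {P = Old} {Q = W ∋_} spanO spanW g∈R (joins-sym j) q∈ Wp (classify u∈) (classify v∈)
      where
      Old : Fin n → Set
      Old y = y ∈ V H × Y ∌ y
      spanO : Spans R Old
      spanO = spans s closed (B∪W⊆R ∘ p⊆p∪q (inside W))
      spanW : Spans R (W ∋_)
      spanW = inside-spans conn-W (B∪W⊆R ∘ q⊆p∪q B (inside W))
      classify : ∀ {u} → u ∈ V H × Y ∖ W ∌ u → Old u ⊎ W ∋ u
      classify {u} (u∈ , ¬Ku) with member? Y u
      ... | inj₁ Yu  = inj₂ (∖-∌⁻ Yu ¬Ku)
      ... | inj₂ ¬Yu = inj₁ (u∈ , ¬Yu)

    shrink : ∀ {Y B W} → State Y B → W ⊑ Y → W ∌ z → ConnG W → ConnG (Y ∖ W) → 2 ≤ link W (∁ Y) →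
             (∀ {v} → W ∋ v → 1 ≤ link ⟪ v ⟫ (Y ∖ W)) → State (Y ∖ W) (B ∪ inside W)
    shrink {Y} {B} {W} s W⊑Y z∉W conn-W conn-K feet attached = record
      { Yz        = ∖⁺ (Yz s) z∉W
      ; ¬Yx       = ∌-⊑ ∖⊑ (¬Yx s)
      ; Y⊆H       = Y⊆H s ∘ ∖⊑
      ; connY     = conn-K
      ; boundary  = boundary-shrink s
      ; B⊆E       = [ B⊆E s , inside⊆E (Y⊆H s ∘ W⊑Y) ]′ ∘ x∈p∪q⁻ B (inside W)
      ; B-outside = λ g∈ j Kp Kq → [ (λ g∈B → B-outside s g∈B j (∖⊑ Kp) (∖⊑ Kq))
                                   , (λ g∈W → ∋∌⇒⊥ (proj₁ (proj₂ (inside⁻ g∈W) j)) (∖-∌ Kp)) ]′ (x∈p∪q⁻ B (inside W) g∈)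
      ; connOff   = connOff-attached (Y⊆H s) W⊑Y (B-outside s) conn-K attached (connOff s)
      ; spans     = spans-shrink s W⊑Y z∉W conn-W feet
      }

    advance : ∀ {Y B y} → State Y B → Y ∋ y → y ≢ z →
              ∃[ W ] W ⊑ Y × (∃[ w ] W ∋ w) × State (Y ∖ W) (B ∪ inside W)
    advance {Y} s Yy y≢z =
      let e , attached = ear s Yy y≢z
          _ , _ , w , _ , _ , Ww , _ = link⇒edge {Ear.W e} {∁ Y} (≤-trans (n≤1+n 1) (Ear.feet e))
      in  Ear.W e , Ear.W⊑Y e , (w , Ww) ,
          shrink s (Ear.W⊑Y e) (Ear.z∉W e) (Ear.conn-W e) (Ear.conn-K e) (Ear.feet e) attached
      where module Ear = Region.Ear

    -- The clause on the origin of the edges serves the exchange in G - r: edges between the first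
    -- ear and the remaining vertices stay out of the final base.
    Completion : VSet n → Subset m → Set
    Completion Y B = ∃[ B′ ] B ⊆ B′ × B′ ⊆ E H × (∀ {g} → g ∈ B′ → g ∈ B ⊎ g ∈ inside Y) × ConnOff B′ × Generates B′

    -- At least three edges lead from `z` to other vertices, and only `c` among them can be missing
    -- from `H`. Two remain for `two-links`, with the single vertex `z` as one of the two sides.
    spans-finish : ∀ {Y B} → State Y B → (∀ {y} → Y ∋ y → y ≡ z) → ∀ {R} → Closed R → B ⊆ R → Spans R (_∈ V H)
    spans-finish {Y} {B} s Y≡z {R} closed B⊆R {u} {v} u∈ v∈ = from-edges
      (link⇒two-edges-avoiding {⟪ z ⟫} {∁ ⟪ z ⟫} c (λ z∈ ∁z∈ → ∋∌⇒⊥ z∈ (∁⁻ ∁z∈))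
        (3≤cut connected ⟪ z ⟫ (proj₁ (joins∈V G c∈ c-joins)) (proj₂ (joins∈V G c∈ c-joins))
          ⟪⟫⁺ (∉⟪⟫ (≢-sym (≢-by (Yz s) (¬Yx s))))))
      where
      Old : Fin n → Set
      Old y = y ∈ V H × Y ∌ y
      spanO : Spans R Old
      spanO = spans s closed B⊆R
      spanz : Spans R (_≡ z)
      spanz refl refl = ε
      ¬Yq : ∀ {y} → ∁ ⟪ z ⟫ ∋ y → Y ∌ y
      ¬Yq ∁y = ¬∋⇒∌ λ Yy → ∋∌⇒⊥ (subst (⟪ z ⟫ ∋_) (sym (Y≡z Yy)) ⟪⟫⁺) (∁⁻ ∁y)
      into-H : ∀ {g p q} → g ∈ E G → g ≢ c → Joins ends g p q → ⟪ z ⟫ ∋ p → ∁ ⟪ z ⟫ ∋ q → g ∈ E H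
      into-H g∈ g≢c j zp ∁q = boundary s g∈ g≢c (joins-sym j) (¬Yq ∁q) (subst (Y ∋_) (sym (⟪⟫⁻ zp)) (Yz s))
      classify : ∀ {u} → u ∈ V H → Old u ⊎ u ≡ z
      classify {u} u∈ with member? Y u
      ... | inj₁ Yu  = inj₂ (Y≡z Yu)
      ... | inj₂ ¬Yu = inj₁ (u∈ , ¬Yu)
      end : ∀ {g p q} → g ∈ E H → Joins ends g p q → ∁ ⟪ z ⟫ ∋ q → Old q
      end g∈H j ∁q = proj₂ (joins∈V H g∈H j) , ¬Yq ∁q
      Exit : Fin m → Set
      Exit g = g ≢ c × g ∈ E G × ∃[ p ] ∃[ q ] Joins ends g p q × ⟪ z ⟫ ∋ p × ∁ ⟪ z ⟫ ∋ q
      from-edges : ∃[ g ] ∃[ h ] g ≢ h × Exit g × Exit h → Star (Via (_∈ R)) u v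
      from-edges (g , h , g≢h , (g≢c , g∈ , p , q , j , zp , ∁q) , (h≢c , h∈ , p′ , q′ , j′ , zp′ , ∁q′)) =
        spans-∪ {P = Old} {Q = _≡ z} spanO spanz g∈R (joins-sym j) q∈ (⟪⟫⁻ zp) (classify u∈) (classify v∈)
        where
        g∈H : g ∈ E H
        g∈H = into-H g∈ g≢c j zp ∁q
        h∈H : h ∈ E H
        h∈H = into-H h∈ h≢c j′ zp′ ∁q′
        q∈ : Old q
        q∈ = end g∈H j ∁q
        g∈R : g ∈ R
        g∈R = two-links {P = Old} {Q = _≡ z} closed spanO spanz g≢h g∈H h∈H
                (joins-sym j) (joins-sym j′) q∈ (⟪⟫⁻ zp) (end h∈H j′ ∁q′) (⟪⟫⁻ zp′)

    inside-mono : ∀ {A A′} → A ⊑ A′ → inside A ⊆ inside A′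
    inside-mono A⊑ {g} g∈ =
      let g∈E , both = inside⁻ g∈
          Ap , Aq    = both (joins-ends g)
      in  inside⁺ g∈E (joins-ends g) (A⊑ Ap) (A⊑ Aq)

    complete : ∀ k {Y B} → size Y ≤ k → State Y B → Completion Y B
    complete k {Y} {B} ≤k s with any? (λ y → (Y ∋? y) ×-dec ¬? (y ≟ z))
    ... | no none = B , id , B⊆E s , inj₁ , connOff s ,
        λ closed B⊆R → span⇒E⊆ closed (spans-finish s (λ {y} → only y) closed B⊆R)
      where
      only : ∀ y → Y ∋ y → y ≡ z
      only y Yy with y ≟ z
      ... | yes y≡z = y≡z
      ... | no  y≢z = ⊥-elim (none (y , Yy , y≢z))
    ... | yes (y , Yy , y≢z) with advance s Yy y≢z
    ... | W , W⊑Y , (w , Ww) , s′ with ≤-trans (size-⊏ ∖⊑ (W⊑Y Ww) (∖-∌⁺ Ww)) ≤k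
    ... | s≤s ≤k′ with complete _ ≤k′ s′
    ... | B′ , B∪W⊆B′ , B′⊆E , origin , conn , gen =
      B′ , B∪W⊆B′ ∘ p⊆p∪q (inside W) , B′⊆E , [ origin-B , inj₂ ∘ inside-mono ∖⊑ ]′ ∘ origin , conn , gen
      where
      origin-B : ∀ {g} → g ∈ B ∪ inside W → g ∈ B ⊎ g ∈ inside Y
      origin-B = [ inj₁ , inj₂ ∘ inside-mono W⊑Y ]′ ∘ x∈p∪q⁻ B (inside W)

-- Cycles from walks

∣p∪q∣≤∣p∣+∣q∣ : ∀ {k} (p q : Subset k) → ∣ p ∪ q ∣ ≤ ∣ p ∣ + ∣ q ∣
∣p∪q∣≤∣p∣+∣q∣ []          []          = z≤n
∣p∪q∣≤∣p∣+∣q∣ (false ∷ p) (false ∷ q) = ∣p∪q∣≤∣p∣+∣q∣ p q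
∣p∪q∣≤∣p∣+∣q∣ (true ∷ p)  (false ∷ q) = s≤s (∣p∪q∣≤∣p∣+∣q∣ p q)
∣p∪q∣≤∣p∣+∣q∣ (false ∷ p) (true ∷ q)  = ≤-trans (s≤s (∣p∪q∣≤∣p∣+∣q∣ p q)) (≤-reflexive (sym (+-suc ∣ p ∣ ∣ q ∣)))
∣p∪q∣≤∣p∣+∣q∣ (true ∷ p)  (true ∷ q)  = s≤s (≤-trans (∣p∪q∣≤∣p∣+∣q∣ p q) (+-monoʳ-≤ ∣ p ∣ (n≤1+n ∣ q ∣)))

module SimplePaths {n m : ℕ} {ends : Ends n m} (F : Fin m → Set) where

  open Joining ends

  mutual

    -- Freshness of the first vertex refers to the vertices of the remaining path, hence the
    -- simultaneous definition with `vertex`.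
    data SimplePath : ℕ → Fin n → Fin n → Set where
      []   : ∀ {u} → SimplePath 0 u u
      cons : ∀ {k u v w} g → F g → Joins ends g u w → (p : SimplePath k w v) →
             (∀ i → vertex p i ≢ u) → SimplePath (suc k) u v

    vertex : ∀ {k u v} → SimplePath k u v → Fin (suc k) → Fin n
    vertex {u = u} _                 zero    = u
    vertex         (cons _ _ _ p _)  (suc i) = vertex p i

  suffix : ∀ {k u v} (p : SimplePath k u v) i → ∃[ l ] SimplePath l (vertex p i) v
  suffix p                zero    = _ , p
  suffix (cons _ _ _ p _) (suc i) = suffix p i

  loop-erase : ∀ {u v} → Star (Via F) u v → ∃[ k ] SimplePath k u v
  loop-erase ε = 0 , []
  loop-erase {u} ((g , Fg , j) ◅ steps) with loop-erase steps
  ... | k , p with any? (λ i → vertex p i ≟ u)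
  ...   | no u∉        = suc k , cons g Fg j p λ i eq → u∉ (i , eq)
  -- If `u` recurs on the remaining path, everything before that recurrence is cut off.
  ...   | yes (i , eq) = subst (λ x → ∃[ l ] SimplePath l x _) eq (suffix p i)

  vertex-injective : ∀ {k u v} (p : SimplePath k u v) → Injective _≡_ _≡_ (vertex p)
  vertex-injective p                 {zero}  {zero}  _  = refl
  vertex-injective (cons _ _ _ _ u∉) {zero}  {suc j} eq = ⊥-elim (u∉ j (sym eq))
  vertex-injective (cons _ _ _ _ u∉) {suc i} {zero}  eq = ⊥-elim (u∉ i eq)
  vertex-injective (cons _ _ _ p _)  {suc i} {suc j} eq = cong suc (vertex-injective p eq)

  vertex-last : ∀ {k u v} (p : SimplePath k u v) → vertex p (fromℕ k) ≡ v
  vertex-last []               = refl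
  vertex-last (cons _ _ _ p _) = vertex-last p

  -- The edges of the path, followed by the closing edge e.
  edge : ∀ {k u v} → Fin m → SimplePath k u v → Fin (suc k) → Fin m
  edge e []               _       = e
  edge e (cons g _ _ _ _) zero    = g
  edge e (cons _ _ _ p _) (suc i) = edge e p i

  edge-last : ∀ {k u v} e (p : SimplePath k u v) → edge e p (fromℕ k) ≡ e
  edge-last e []               = refl
  edge-last e (cons _ _ _ p _) = edge-last e p

  edge-joins : ∀ {k u v} e (p : SimplePath k u v) (i : Fin k) →
               Joins ends (edge e p (inject₁ i)) (vertex p (inject₁ i)) (vertex p (suc i))
  edge-joins e (cons g _ j [] _)                 zero    = j
  edge-joins e (cons g _ j (cons _ _ _ _ _) _)   zero    = j
  edge-joins e (cons _ _ _ p _)                  (suc i) = edge-joins e p i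

  edge-F : ∀ {k u v} e (p : SimplePath k u v) i → F (edge e p i) ⊎ edge e p i ≡ e
  edge-F e []                _       = inj₂ refl
  edge-F e (cons _ Fg _ _ _) zero    = inj₁ Fg
  edge-F e (cons _ _ _ p _)  (suc i) = edge-F e p i

  -- Both ends of a path edge lie on the path, so an edge at a vertex off the path could coincide
  -- only with the closing edge `e`.
  off-path : ∀ {k u v w x e g} (p : SimplePath k u v) → Joins ends g w x → g ≢ e →
             (∀ i → vertex p i ≢ w) → ∀ i → g ≢ edge e p i
  off-path []                 j g≢e w∉ _    refl = g≢e refl
  off-path (cons h _ j′ p _) j g≢e w∉ zero refl with joins-pair j j′
  ... | inj₁ (refl , _) = w∉ zero refl
  ... | inj₂ (refl , _) = w∉ (suc zero) refl
  off-path (cons _ _ _ p _)  j g≢e w∉ (suc i) = off-path p j g≢e (w∉ ∘ suc) i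

  edge-injective : ∀ {k u v e} → (∀ {g} → F g → g ≢ e) → (p : SimplePath k u v) → Injective _≡_ _≡_ (edge e p)
  edge-injective F≢e []                  {zero}  {zero}  _  = refl
  edge-injective F≢e (cons _ _ _ _ _)    {zero}  {zero}  _  = refl
  edge-injective F≢e (cons _ Fg j p u∉)  {zero}  {suc i} eq = ⊥-elim (off-path p j (F≢e Fg) u∉ i eq)
  edge-injective F≢e (cons _ Fg j p u∉)  {suc i} {zero}  eq = ⊥-elim (off-path p j (F≢e Fg) u∉ i (sym eq))
  edge-injective F≢e (cons _ _ _ p _)    {suc i} {suc k} eq = cong suc (edge-injective F≢e p eq)

  module _ {k u v e} (p : SimplePath k u v) (e-joins : Joins ends e u v) (F≢e : ∀ {g} → F g → g ≢ e) where

    closing : Joins ends (edge e p (fromℕ k)) (vertex p (fromℕ k)) (vertex p zero)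
    closing = subst₂ (λ g x → Joins ends g x u) (sym (edge-last e p)) (sym (vertex-last p)) (joins-sym e-joins)

    edge-ends : ∀ i → ∃[ a ] ∃[ b ] Joins ends (edge e p i) (vertex p a) (vertex p b)
    edge-ends i with view i
    ... | ‵fromℕ     = fromℕ k , zero , closing
    ... | ‵inject₁ i = inject₁ i , suc i , edge-joins e p i

    vertex-incident : ∀ i → ∃[ x ] Joins ends (edge e p i) (vertex p i) x
    vertex-incident i with view i
    ... | ‵fromℕ     = _ , closing
    ... | ‵inject₁ i = _ , edge-joins e p i

    on-path : Subset n
    on-path = tabulate λ x → does (any? λ i → vertex p i ≟ x)

    on-path⁺ : ∀ {x} → (∃[ i ] vertex p i ≡ x) → x ∈ on-path
    on-path⁺ {x} ∃i = ∈-tabulate⁺ (dec-true (any? λ i → vertex p i ≟ x) ∃i)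

    on-path⁻ : ∀ {x} → x ∈ on-path → ∃[ i ] vertex p i ≡ x
    on-path⁻ {x} x∈ = does-sound (any? λ i → vertex p i ≟ x) (∈-tabulate⁻ {f = λ y → does (any? λ i → vertex p i ≟ y)} x∈)

    of-path : Subset m
    of-path = tabulate λ g → does (any? λ i → edge e p i ≟ g)

    of-path⁺ : ∀ {g} → (∃[ i ] edge e p i ≡ g) → g ∈ of-path
    of-path⁺ {g} ∃i = ∈-tabulate⁺ (dec-true (any? λ i → edge e p i ≟ g) ∃i)

    of-path⁻ : ∀ {g} → g ∈ of-path → ∃[ i ] edge e p i ≡ g
    of-path⁻ {g} g∈ = does-sound (any? λ i → edge e p i ≟ g) (∈-tabulate⁻ {f = λ h → does (any? λ i → edge e p i ≟ h)} g∈)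

    cycle : Graph ends
    cycle = record { V = on-path ; E = of-path ; ends∈V = cycle-ends }
      where
      cycle-ends : ∀ {g} → g ∈ of-path → proj₁ (ends g) ∈ on-path × proj₂ (ends g) ∈ on-path
      cycle-ends {g} g∈ with of-path⁻ g∈
      ... | i , refl with edge-ends i
      ...   | a , b , j with joins-pair (joins-ends g) j
      ...     | inj₁ (u≡ , v≡) = on-path⁺ (a , sym u≡) , on-path⁺ (b , sym v≡)
      ...     | inj₂ (u≡ , v≡) = on-path⁺ (b , sym u≡) , on-path⁺ (a , sym v≡)

    isCycle : IsCycle cycle
    isCycle = record
      { ℓ = k ; vertex = vertex p ; edge = edge e p
      ; vertex-injective = vertex-injective p ; edge-injective = edge-injective F≢e p
      ; joins = edge-joins e p ; closes = closing
      ; V-range = λ x → mk⇔ on-path⁻ on-path⁺ ; E-range = λ g → mk⇔ of-path⁻ of-path⁺ }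

    e∈cycle : e ∈ E cycle
    e∈cycle = of-path⁺ (fromℕ k , edge-last e p)

    cycle⊆F∪e : ∀ {g} → g ∈ E cycle → F g ⊎ g ≡ e
    cycle⊆F∪e g∈ with of-path⁻ g∈
    ... | i , refl = edge-F e p i

    cycle⊆ : ∀ {H : Graph ends} → e ∈ E H → (∀ {g} → F g → g ∈ E H) → cycle ⊆ᴳ H
    cycle⊆ {H} e∈ F⊆ = V⊆ , E⊆
      where
      E⊆ : E cycle ⊆ E H
      E⊆ g∈ = [ F⊆ , (λ { refl → e∈ }) ]′ (cycle⊆F∪e g∈)
      V⊆ : V cycle ⊆ V H
      V⊆ x∈ with on-path⁻ x∈
      ... | i , refl with vertex-incident i
      ...   | y , inj₁ eq = subst (_∈ V H) (cong proj₁ eq) (proj₁ (ends∈V H (E⊆ (of-path⁺ (i , refl)))))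
      ...   | y , inj₂ eq = subst (_∈ V H) (cong proj₂ eq) (proj₂ (ends∈V H (E⊆ (of-path⁺ (i , refl)))))

-- From 2-closed edge-sets to bases

module _ {n m : ℕ} {ends : Ends n m} (H : Graph ends) where

  open Joining ends
  open Closure H

  -- A simple path within the walk forms a cycle with `e`. On it only `e` and `f` can lie outside
  -- `R`, whereas a 2-closed `R` that misses `e` would need three such edges.
  2-closed⇒Closed : ∀ {S R} → KClosedOver H 2 S R → Closed R
  2-closed⇒Closed {S} {R} K = record { R⊆E = KClosedOver.R⊆E K ; absorb = absorb′ }
    where
    open KClosedOver K using (cycles)
    absorb′ : ∀ {e f u v} → e ∈ E H → f ∈ E H → Joins ends e u v →
              Star (Via λ g → g ≢ e × (g ∈ R ⊎ g ≡ f)) u v → e ∈ R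
    absorb′ {e} {f} e∈ f∈ j path with e ∈? R
    ... | yes e∈R = e∈R
    ... | no  e∉R with SimplePaths.loop-erase (λ g → g ≢ e × (g ∈ R ⊎ g ≡ f)) path
    ... | k , p = ⊥-elim (1+n≰n (≤-trans (cycles C C⊆H (isCycle p j proj₁) (e , e∈C─R)) ∣C─R∣≤2))
      where
      open SimplePaths (λ g → g ≢ e × (g ∈ R ⊎ g ≡ f))
      C : Graph ends
      C = cycle p j proj₁
      C⊆H : C ⊆ᴳ H
      C⊆H = cycle⊆ p j proj₁ {H} e∈ λ (_ , g∈) → [ KClosedOver.R⊆E K , (λ { refl → f∈ }) ]′ g∈
      e∈C─R : e ∈ E C ─ R
      e∈C─R = x∈p∧x∉q⇒x∈p─q (e∈cycle p j proj₁) e∉R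
      C─R⊆ : E C ─ R ⊆ ⁅ e ⁆ ∪ ⁅ f ⁆
      C─R⊆ g∈ with cycle⊆F∪e p j proj₁ (p─q⊆p (E C) R g∈)
      ... | inj₂ refl              = p⊆p∪q ⁅ f ⁆ (x∈⁅x⁆ e)
      ... | inj₁ (_ , inj₂ refl)   = q⊆p∪q ⁅ e ⁆ ⁅ f ⁆ (x∈⁅x⁆ f)
      ... | inj₁ (_ , inj₁ g∈R)    = ⊥-elim (x∈p─q⇒x∉q (E C) R g∈ g∈R)
      ∣C─R∣≤2 : ∣ E C ─ R ∣ ≤ 2
      ∣C─R∣≤2 = begin
        ∣ E C ─ R ∣              ≤⟨ p⊆q⇒∣p∣≤∣q∣ C─R⊆ ⟩
        ∣ ⁅ e ⁆ ∪ ⁅ f ⁆ ∣        ≤⟨ ∣p∪q∣≤∣p∣+∣q∣ ⁅ e ⁆ ⁅ f ⁆ ⟩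
        ∣ ⁅ e ⁆ ∣ + ∣ ⁅ f ⁆ ∣    ≡⟨ cong₂ _+_ (∣⁅x⁆∣≡1 e) (∣⁅x⁆∣≡1 f) ⟩
        2                        ∎
        where open ≤-Reasoning

  generates⇒base : ∀ {B} → B ⊆ E H → Generates B → IsBase 2 H B
  generates⇒base {B} B⊆E gen = B⊆E , record
    { closed = record
        { S⊆R = B⊆E ; R⊆E = id
        ; cycles = λ C C⊆H _ (e , e∈) →
            ⊥-elim (x∈p─q⇒x∉q (E C) (E H) e∈ (proj₂ C⊆H (p─q⊆p (E C) (E H) e∈))) }
    ; minimal = λ R′ K R′⊆E → ⊆-antisym R′⊆E (gen (2-closed⇒Closed K) (KClosedOver.S⊆R K)) }

  peripheral-base : ∀ {B} → B ⊆ E H → Conn (λ g → g ∈ E H × g ∉ B) (_∈ V H) → Generates B → PeripheralBase 2 H B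
  peripheral-base {B} B⊆E conn gen = (B⊆E , connected) , generates⇒base B⊆E gen
    where
    connected : Connected (deleteEdges H B)
    connected u∈ v∈ = Star.map (λ (g , (g∈ , g∉) , j) → g , x∈p∧x∉q⇒x∈p─q g∈ g∉ , j) (conn⇒star conn u∈ v∈)

-- Bases containing a peripheral cycle

⌊_⌋ : ∀ {n} → Subset n → VSet n
⌊ S ⌋ = comprehension (_∈? S)

⌊⌋⁺ : ∀ {n} {S : Subset n} {x} → x ∈ S → ⌊ S ⌋ ∋ x
⌊⌋⁺ {S = S} = comprehension⁺ {P? = _∈? S}

⌊⌋⁻ : ∀ {n} {S : Subset n} {x} → ⌊ S ⌋ ∋ x → x ∈ S
⌊⌋⁻ {S = S} = comprehension⁻ {P? = _∈? S}

⌊⌋-∌⁺ : ∀ {n} {S : Subset n} {x} → x ∉ S → ⌊ S ⌋ ∌ x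
⌊⌋-∌⁺ x∉ = ¬∋⇒∌ (x∉ ∘ ⌊⌋⁻)

module Cycles {n m : ℕ} {ends : Ends n m} {C : Graph ends} (cyc : IsCycle C) where

  open Joining ends
  open IsCycle cyc

  edge∈ : ∀ i → edge i ∈ E C
  edge∈ i = Equivalence.from (E-range (edge i)) (i , refl)

  index : ∀ {v} → v ∈ V C → ∃[ i ] vertex i ≡ v
  index {v} = Equivalence.to (V-range v)

  outgoing : ∀ i → ∃[ x ] Joins ends (edge i) (vertex i) x
  outgoing i with view i
  ... | ‵fromℕ     = _ , closes
  ... | ‵inject₁ i = _ , joins i

  Loop-at Pair-at : Fin n → Set
  Loop-at v = ∃[ c ] c ∈ E C × Joins ends c v v
  Pair-at v = ∃[ c ] ∃[ d ] c ≢ d × (c ∈ E C × ∃[ x ] Joins ends c v x) × (d ∈ E C × ∃[ y ] Joins ends d v y)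

  -- A cycle of length 1 has no second edge, but its loop counts twice in the degree; so `C`
  -- contributes 2 to the degree of `v` in both cases.
  loop⊎pair : ∀ {v} → v ∈ V C → Loop-at v ⊎ Pair-at v
  loop⊎pair v∈ with index v∈
  ... | i , refl = at ℓ refl i
    where
    inject₁≢suc : ∀ {k} (j : Fin k) → inject₁ j ≢ suc j
    inject₁≢suc j eq = 1+n≢n (sym (trans (sym (toℕ-inject₁ j)) (cong toℕ eq)))
    at : ∀ l → l ≡ ℓ → (i : Fin (suc ℓ)) → Loop-at (vertex i) ⊎ Pair-at (vertex i)
    at zero    refl zero    = inj₁ (edge zero , edge∈ zero , closes)
    at (suc l) refl zero    = inj₂ (edge zero , edge (fromℕ (suc l)) , (λ eq → zero≢suc (edge-injective eq)) ,
                                    (edge∈ zero , outgoing zero) , (edge∈ _ , _ , joins-sym closes))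
      where
      zero≢suc : ∀ {k} {j : Fin k} → Fin.zero ≢ suc j
      zero≢suc ()
    at (suc l) refl (suc j) = inj₂ (edge (inject₁ j) , edge (suc j) , (λ eq → inject₁≢suc j (edge-injective eq)) ,
                                    (edge∈ _ , _ , joins-sym (joins j)) , (edge∈ _ , outgoing (suc j)))

  spans-cycle : ∀ {R : Subset m} → E C ⊆ R → ∀ {u v} → u ∈ V C → v ∈ V C → Star (Via (_∈ R)) u v
  spans-cycle {R} C⊆R u∈ v∈ with index u∈ | index v∈
  ... | i , refl | k , refl = Star.reverse via-sym (from-zero i) ◅◅ from-zero k
    where
    from-zero : ∀ i → Star (Via (_∈ R)) (vertex zero) (vertex i)
    from-zero = <-weakInduction (λ i → Star (Via (_∈ R)) (vertex zero) (vertex i)) ε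
      λ i path → path ◅◅ (edge (inject₁ i) , C⊆R (edge∈ _) , joins i) ◅ ε

module PeripheralCycle {n m : ℕ} {ends : Ends n m} (G : Graph ends) (connected : EdgeConnected 3 G) (cubic : Cubic G)
                       (C : Graph ends) (C⊆G : C ⊆ᴳ G) (cyc : IsCycle C) (peripheral : Peripheral G (E C)) where

  open Ears G connected cubic
  open Growth G connected cubic G (id , id) (λ g∈ _ _ _ → g∈)
  open Cycles cyc

  joins⇒weight : ∀ {g p q} → g ∈ E G → Joins ends g p q → 1 ≤ weight ⟪ p ⟫ full g
  joins⇒weight g∈ j = edge-weight g∈ j ⟪⟫⁺ full-∋

  -- `C` takes up 2 of the degree 3 at `p`, by a loop or by two edges, which leaves room for a
  -- single edge outside `C`.
  third-edge : ∀ {p g h q r} → p ∈ V C → g ∈ E G → h ∈ E G → g ∉ E C → h ∉ E C →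
               Joins ends g p q → Joins ends h p r → g ≡ h
  third-edge {p} {g} {h} p∈ g∈ h∈ g∉ h∉ jg jh with g ≟ h
  ... | yes g≡h = g≡h
  ... | no g≢h = ⊥-elim (1+n≰n (≤-trans (many (loop⊎pair p∈)) (≤-reflexive (degree≡3 (proj₁ C⊆G p∈)))))
    where
    ≢C : ∀ {c f} → c ∈ E C → f ∉ E C → c ≢ f
    ≢C c∈ f∉ refl = f∉ c∈
    many : Loop-at p ⊎ Pair-at p → 4 ≤ link ⟪ p ⟫ full
    many (inj₁ (c , c∈ , jc)) =
      ≤-trans (+-mono-≤ (loop-weight (proj₂ C⊆G c∈) jc ⟪⟫⁺)
                (+-mono-≤ (joins⇒weight g∈ jg) (+-mono-≤ (joins⇒weight h∈ jh) (z≤n {0}))))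
        (sum-unique (weight ⟪ p ⟫ full) ((≢C c∈ g∉ ∷ ≢C c∈ h∉ ∷ []) ∷ (g≢h ∷ []) ∷ [] ∷ []))
    many (inj₂ (c , d , c≢d , (c∈ , _ , jc) , (d∈ , _ , jd))) =
      ≤-trans (+-mono-≤ (joins⇒weight (proj₂ C⊆G c∈) jc) (+-mono-≤ (joins⇒weight (proj₂ C⊆G d∈) jd)
                (+-mono-≤ (joins⇒weight g∈ jg) (+-mono-≤ (joins⇒weight h∈ jh) (z≤n {0})))))
        (sum-unique (weight ⟪ p ⟫ full)
          ((c≢d ∷ ≢C c∈ g∉ ∷ ≢C c∈ h∉ ∷ []) ∷ (≢C d∈ g∉ ∷ ≢C d∈ h∉ ∷ []) ∷ (g≢h ∷ []) ∷ [] ∷ []))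

  Y : VSet n
  Y = ⌊ V G ⌋ ∖ ⌊ V C ⌋

  Y⊆G : ∀ {y} → Y ∋ y → y ∈ V G
  Y⊆G = ⌊⌋⁻ ∘ ∖⊑

  Y∌C : ∀ {y} → y ∈ V C → Y ∌ y
  Y∌C = ∖-∌⁺ ∘ ⌊⌋⁺

  ¬Y⇒C : ∀ {y} → y ∈ V G → Y ∌ y → y ∈ V C
  ¬Y⇒C y∈ ¬Yy = ⌊⌋⁻ (∖-∌⁻ (⌊⌋⁺ y∈) ¬Yy)

  conn-off-C : ConnOff (E C)
  conn-off-C = star⇒conn (λ (g∈ , _) j → joins∈V G g∈ j) λ x∈ y∈ →
    Star.map (λ (g , g∈ , j) → g , (p─q⊆p (E G) (E C) g∈ , x∈p─q⇒x∉q (E G) (E C) g∈) , j) (proj₂ peripheral x∈ y∈)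

  -- A vertex of C has only one edge outside E C, so a set of vertices of Y extends to
  -- the vertices of C that hang on it without creating new crossing edges.
  connY : ConnG Y
  connY U {x} {y} Yx Yy Ux Uy = from-crossing
    (conn-off-C U′ (Y⊆G Yx) (Y⊆G Yy) (∪⁺ˡ (∩⁺ Ux Yx)) (∪-∌⁺ (∌-⊑ (proj₁ ∘ ∩⁻) Uy) (∌-⊑ (proj₂ ∘ ∩⁻) (∖-∌ Yy))))
    where
    Hangs : Fin n → Set
    Hangs v = ∃[ g ] ∃[ t ] (g ∈ E G × g ∉ E C) × Joins ends g v t × Y ∋ t × U ∋ t
    joins? : ∀ g v t → Dec (Joins ends g v t)
    joins? g v t = ≡-dec _≟_ _≟_ (ends g) (v , t) ⊎-dec ≡-dec _≟_ _≟_ (ends g) (t , v)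
    hangs? : ∀ v → Dec (Hangs v)
    hangs? v = any? λ g → any? λ t →
      ((g ∈? E G) ×-dec ¬? (g ∈? E C)) ×-dec joins? g v t ×-dec (Y ∋? t) ×-dec (U ∋? t)
    U′ : VSet n
    U′ = (U ∩ᵛ Y) ∪ᵛ (comprehension hangs? ∩ᵛ ⌊ V C ⌋)
    from-crossing : Crosses (λ g → g ∈ E G × g ∉ E C) (_∈ V G) U′ → Crosses (_∈ E G) (Y ∋_) U
    from-crossing (g , p , q , (g∈ , g∉) , j , p∈ , q∈ , U′p , ¬U′q) with ∪⁻ U′p | member? Y q
    ... | inj₁ UYp | inj₁ Yq =
      g , p , q , g∈ , j , proj₂ (∩⁻ UYp) , Yq , proj₁ (∩⁻ UYp) , ¬∋⇒∌ λ Uq → ∋∌⇒⊥ (∪⁺ˡ (∩⁺ Uq Yq)) ¬U′q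
    ... | inj₁ UYp | inj₂ ¬Yq = ⊥-elim (∋∌⇒⊥ (∪⁺ʳ (∩⁺ (comprehension⁺ {P? = hangs?} hang) (⌊⌋⁺ (¬Y⇒C q∈ ¬Yq)))) ¬U′q)
      where
      hang : Hangs q
      hang = g , p , (g∈ , g∉) , joins-sym j , proj₂ (∩⁻ UYp) , proj₁ (∩⁻ UYp)
    ... | inj₂ Hp | _ with comprehension⁻ {P? = hangs?} (proj₁ (∩⁻ Hp))
    ...   | h , t , (h∈ , h∉) , k , Yt , Ut with third-edge (⌊⌋⁻ (proj₂ (∩⁻ Hp))) g∈ h∈ g∉ h∉ j k
    ...     | refl with joins-other j k
    ...       | refl = ⊥-elim (∋∌⇒⊥ (∪⁺ˡ (∩⁺ Ut Yt)) ¬U′q)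

  Result : Set
  Result = ∃[ B ] PeripheralBase 2 G B × E C ⊆ B

  -- There is no vertex to choose as `z`, but `E C` is already a base: every edge joins two vertices
  -- of `C`, so one off `C` closes a cycle that has no other edge outside `E C`.
  spanning : (∀ {y} → Y ∋ y → ⊥) → Result
  spanning ¬Y = E C , peripheral-base G (proj₂ C⊆G) conn-off-C
      (λ closed C⊆R → span⇒E⊆ closed λ u∈ v∈ → spans-cycle C⊆R (V⊆C u∈) (V⊆C v∈)) , id
    where
    V⊆C : ∀ {v} → v ∈ V G → v ∈ V C
    V⊆C v∈ = ¬Y⇒C v∈ (¬∋⇒∌ ¬Y)

  extend : Edge Y (∁ Y) → Result
  extend (c , c∈ , z , x , j , Yz , ∁x) with complete c∈ j _ ≤-refl initial-state
    where
    initial-state : State c∈ j Y (E C)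
    initial-state = record
      { Yz = Yz ; ¬Yx = ∁⁻ ∁x ; Y⊆H = Y⊆G ; connY = connY
      ; boundary = λ g∈ _ _ _ _ → g∈
      ; B⊆E = proj₂ C⊆G
      ; B-outside = λ g∈ k Yp _ → ∋∌⇒⊥ Yp (Y∌C (proj₁ (joins∈C g∈ k)))
      ; connOff = conn-off-C
      ; spans = λ _ C⊆R (u∈ , ¬Yu) (v∈ , ¬Yv) → spans-cycle C⊆R (¬Y⇒C u∈ ¬Yu) (¬Y⇒C v∈ ¬Yv)
      }
      where
      joins∈C : ∀ {g p q} → g ∈ E C → Joins ends g p q → p ∈ V C × q ∈ V C
      joins∈C = joins∈V C
  ... | B , C⊆B , B⊆E , _ , conn , gen = B , peripheral-base G B⊆E conn gen , C⊆B

  peripheral-base-⊇C : Result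
  peripheral-base-⊇C with any? (Y ∋?_)
  ... | no ¬Y = spanning λ {y} Yy → ¬Y (y , Yy)
  ... | yes (y , Yy) = extend (link⇒edge (≤-trans (s≤s z≤n)
    (3≤cut connected Y (Y⊆G Yy) (proj₁ C⊆G v∈) Yy (Y∌C v∈))))
    where
    v∈ : IsCycle.vertex cyc zero ∈ V C
    v∈ = Equivalence.from (IsCycle.V-range cyc _) (zero , refl)

-- Exchange at a vertex of degree 2

module Exchange {n m : ℕ} {ends : Ends n m} (H : Graph ends) where

  open Joining ends
  open Closure H

  -- The fields put `e` and `f` in series: as `a` has no other edge in `H` and neither of them is a
  -- loop, every cycle through one passes through the other.
  record Exchangeable (B : Subset m) (a : Fin n) : Set where
    field
      {e f}   : Fin m
      {w k}   : Fin n
      e-joins : Joins ends e a w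
      f-joins : Joins ends f a k
      w≢a     : w ≢ a
      k≢a     : k ≢ a
      e∈B     : e ∈ B
      f∈E     : f ∈ E H
      f∉B     : f ∉ B
      only    : ∀ {g x} → g ∈ E H → Joins ends g a x → g ≡ e ⊎ g ≡ f

  redirect : Fin n → Fin n → Fin n → Fin n
  redirect a k x = if does (x ≟ a) then k else x

  redirect-≡ : ∀ a k → redirect a k a ≡ k
  redirect-≡ a k rewrite dec-true (a ≟ a) refl = refl

  redirect-≢ : ∀ {a k x} → x ≢ a → redirect a k x ≡ x
  redirect-≢ {a} {k} {x} x≢a rewrite dec-false (x ≟ a) x≢a = refl

  -- Since no edge of `F` but `d` can meet `a`, contracting `d` costs nothing: `redirect` sends `a`
  -- to `k`, and walks become walks that avoid `d`.
  contract-pendant : ∀ {F F′ : Fin m → Set} {a k d u v} → k ≢ a → Joins ends d a k →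
    (∀ {g x} → F g → Joins ends g a x → g ≡ d) → (∀ {g} → F g → g ≢ d → F′ g) →
    Star (Via F) u v → Star (Via F′) (redirect a k u) (redirect a k v)
  contract-pendant k≢a d-joins pendant F⇒F′ ε = ε
  contract-pendant {F} {F′} {a} {k} {d} k≢a d-joins pendant F⇒F′ (_◅_ {x} {y} (g , Fg , j) path) =
    step (g ≟ d) ◅◅ contract-pendant k≢a d-joins pendant F⇒F′ path
    where
    step : Dec (g ≡ d) → Star (Via F′) (redirect a k x) (redirect a k y)
    step (yes refl) with joins-pair j d-joins
    ... | inj₁ (refl , refl) = subst (Star _ _) (trans (redirect-≡ a k) (sym (redirect-≢ k≢a))) ε
    ... | inj₂ (refl , refl) = subst (Star _ _) (trans (redirect-≢ k≢a) (sym (redirect-≡ a k))) ε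
    step (no g≢d) = subst₂ (Star _) (sym (redirect-≢ x≢a)) (sym (redirect-≢ y≢a)) ((g , F⇒F′ Fg g≢d , j) ◅ ε)
      where
      x≢a : x ≢ a
      x≢a refl = g≢d (pendant Fg j)
      y≢a : y ≢ a
      y≢a refl = g≢d (pendant Fg (joins-sym j))

  module _ {B : Subset m} {a : Fin n} (ex : Exchangeable B a) where

    open Exchangeable ex

    exchange : Subset m
    exchange = (B - e) ∪ ⁅ f ⁆

    f∈exchange : f ∈ exchange
    f∈exchange = q⊆p∪q (B - e) ⁅ f ⁆ (x∈⁅x⁆ f)

    e≢f : e ≢ f
    e≢f refl = f∉B e∈B

    exchange⁻ : ∀ {g} → g ∈ exchange → (g ∈ B × g ≢ e) ⊎ g ≡ f
    exchange⁻ {g} g∈ with x∈p∪q⁻ (B - e) ⁅ f ⁆ g∈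
    ... | inj₁ g∈B-e = inj₁ (p─q⊆p B ⁅ e ⁆ g∈B-e , λ { refl → x∈p─q⇒x∉q B ⁅ e ⁆ g∈B-e (x∈⁅x⁆ e) })
    ... | inj₂ g∈f   = inj₂ (x∈⁅y⁆⇒x≡y f g∈f)

    module _ (B⊆E : B ⊆ E H) where

      exchange⊆E : exchange ⊆ E H
      exchange⊆E g∈ with exchange⁻ g∈
      ... | inj₁ (g∈B , _) = B⊆E g∈B
      ... | inj₂ refl      = f∈E

      -- Outside `B`, the vertex `a` is a leaf hanging on `f`, so contracting `f` leaves the other
      -- vertices connected. The edge `e` is free after the exchange and attaches `a` again.
      connOff-exchange : ConnOff B → ConnOff exchange
      connOff-exchange conn = star⇒conn (λ (g∈ , _) j → joins∈V H g∈ j) λ {x} {y} x∈ y∈ → path x∈ y∈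
        where
        F : Fin m → Set
        F g = g ∈ E H × g ∉ exchange
        w∈ : w ∈ V H
        w∈ = proj₂ (joins∈V H (B⊆E e∈B) e-joins)
        Fe : F e
        Fe = B⊆E e∈B , [ (λ (_ , e≢e) → e≢e refl) , e≢f ]′ ∘ exchange⁻
        leave-a : ∀ {x} → x ∈ V H → ∃[ y ] y ≢ a × y ∈ V H × Star (Via F) x y
        leave-a {x} x∈ with x ≟ a
        ... | yes refl = w , w≢a , w∈ , (e , Fe , e-joins) ◅ ε
        ... | no x≢a   = x , x≢a , x∈ , ε
        between : ∀ {x y} → x ≢ a → y ≢ a → x ∈ V H → y ∈ V H → Star (Via F) x y
        between x≢a y≢a x∈ y∈ = subst₂ (Star _) (redirect-≢ x≢a) (redirect-≢ y≢a)
          (contract-pendant k≢a f-joins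
            (λ (g∈ , g∉B) j → [ (λ { refl → ⊥-elim (g∉B e∈B) }) , id ]′ (only g∈ j))
            (λ (g∈ , g∉B) g≢f → g∈ , [ g∉B ∘ proj₁ , g≢f ]′ ∘ exchange⁻)
            (conn⇒star conn x∈ y∈))
        path : ∀ {x y} → x ∈ V H → y ∈ V H → Star (Via F) x y
        path x∈ y∈ with leave-a x∈ | leave-a y∈
        ... | x′ , x′≢a , x′∈ , to-x′ | y′ , y′≢a , y′∈ , to-y′ =
          to-x′ ◅◅ between x′≢a y′≢a x′∈ y′∈ ◅◅ Star.reverse via-sym to-y′

    -- The edges e and f are in series in H, so exchanging them preserves closedness.
    closed-exchange : ∀ {R} → Closed R → e ∈ E H → f ∈ R → e ∉ R → Closed ((R - f) ∪ ⁅ e ⁆)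
    closed-exchange {R} closed e∈E f∈R e∉R = record
      { R⊆E = λ g∈ → [ (λ (g∈R , _) → R⊆E closed g∈R) , (λ { refl → e∈E }) ]′ (R′⁻ g∈)
      ; absorb = absorb′ }
      where
      R′ : Subset m
      R′ = (R - f) ∪ ⁅ e ⁆
      R′⁺ : ∀ {g} → g ∈ R → g ≢ f → g ∈ R′
      R′⁺ g∈R g≢f = p⊆p∪q ⁅ e ⁆ (x∈p∧x≢y⇒x∈p-y g∈R g≢f)
      R′⁻ : ∀ {g} → g ∈ R′ → (g ∈ R × g ≢ f) ⊎ g ≡ e
      R′⁻ {g} g∈ with x∈p∪q⁻ (R - f) ⁅ e ⁆ g∈
      ... | inj₁ g∈R-f = inj₁ (p─q⊆p R ⁅ f ⁆ g∈R-f , λ { refl → x∈p─q⇒x∉q R ⁅ f ⁆ g∈R-f (x∈⁅x⁆ f) })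
      ... | inj₂ g∈e   = inj₂ (x∈⁅y⁆⇒x≡y e g∈e)
      Step : Fin m → Fin m → Fin m → Set
      Step g h i = i ≢ g × (i ∈ R′ ⊎ i ≡ h)
      at-a : ∀ {g h} → h ∈ E H → (∀ {i} → Step g h i → i ≢ f) → ∀ {i x} → Step g h i → Joins ends i a x → i ≡ e
      at-a h∈ ≢f s@(_ , inj₂ refl) j = [ id , (λ i≡f → ⊥-elim (≢f s i≡f)) ]′ (only h∈ j)
      at-a h∈ ≢f s@(_ , inj₁ i∈R′) j with R′⁻ i∈R′
      ... | inj₂ i≡e         = i≡e
      ... | inj₁ (i∈R , i≢f) = [ id , (λ i≡f → ⊥-elim (i≢f i≡f)) ]′ (only (R⊆E closed i∈R) j)
      avoid-e : ∀ {g h i} → Step g h i → i ≢ e → i ≢ g × (i ∈ R ⊎ i ≡ h)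
      avoid-e (i≢g , inj₂ i≡h) _ = i≢g , inj₂ i≡h
      avoid-e (i≢g , inj₁ i∈R′) i≢e with R′⁻ i∈R′
      ... | inj₁ (i∈R , _) = i≢g , inj₁ i∈R
      ... | inj₂ i≡e       = ⊥-elim (i≢e i≡e)
      -- A walk from `a` to `k` that avoids `f` meets `a` only by `e`. Contracting `e` and appending
      -- `f`, which lies in `R`, gives a walk from `w` to `a` by which `R` would absorb `e`.
      absorb-f : ∀ {h} → h ∈ E H → Star (Via (Step f h)) a k → ⊥
      absorb-f {h} h∈ path = e∉R (absorb closed e∈E h∈ (joins-sym e-joins)
        (subst₂ (Star _) (redirect-≡ a w) (redirect-≢ k≢a)
          (contract-pendant w≢a e-joins (at-a h∈ proj₁)
            (λ s i≢e → i≢e , proj₂ (avoid-e s i≢e)) path)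
         ◅◅ (f , (≢-sym e≢f , inj₁ f∈R) , joins-sym f-joins) ◅ ε))
      -- If `h` is `f`, then it lies in `R`, and `e` takes over as the second edge outside `R`. If
      -- not, the walk avoids `f`, and `a` is a leaf on `e` that can be contracted away.
      absorb-other : ∀ {g h u v} → g ≢ e → g ≢ f → g ∈ E H → h ∈ E H → Joins ends g u v →
                     Star (Via (Step g h)) u v → Dec (h ≡ f) → g ∈ R
      absorb-other {g} g≢e g≢f g∈ h∈ j path (yes refl) =
        absorb closed g∈ e∈E j (Star.map (λ (i , s , k) → i , convert s , k) path)
        where
        convert : ∀ {i} → Step g f i → i ≢ g × (i ∈ R ⊎ i ≡ e)
        convert (i≢g , inj₂ refl) = i≢g , inj₁ f∈R
        convert (i≢g , inj₁ i∈R′) = i≢g , [ inj₁ ∘ proj₁ , inj₂ ]′ (R′⁻ i∈R′)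
      absorb-other {g} {h} g≢e g≢f g∈ h∈ j path (no h≢f) =
        absorb closed g∈ h∈ j
          (subst₂ (Star _) (redirect-≢ u≢a) (redirect-≢ v≢a)
            (contract-pendant w≢a e-joins (at-a h∈ not-f) avoid-e path))
        where
        not-f : ∀ {i} → Step g h i → i ≢ f
        not-f (_ , inj₂ refl) = h≢f
        not-f (_ , inj₁ i∈R′) = [ proj₂ , (λ { refl → e≢f }) ]′ (R′⁻ i∈R′)
        u≢a : _ ≢ a
        u≢a refl = [ g≢e , g≢f ]′ (only g∈ j)
        v≢a : _ ≢ a
        v≢a refl = [ g≢e , g≢f ]′ (only g∈ (joins-sym j))
      absorb′ : ∀ {g h u v} → g ∈ E H → h ∈ E H → Joins ends g u v → Star (Via (Step g h)) u v → g ∈ R′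
      absorb′ {g} {h} g∈ h∈ j path with g ≟ e | g ≟ f
      ... | yes refl | _ = q⊆p∪q (R - f) ⁅ e ⁆ (x∈⁅x⁆ e)
      ... | no g≢e | no g≢f = R′⁺ (absorb-other g≢e g≢f g∈ h∈ j path (h ≟ f)) g≢f
      ... | no _ | yes refl with joins-pair j f-joins
      ...   | inj₁ (refl , refl) = ⊥-elim (absorb-f h∈ path)
      ...   | inj₂ (refl , refl) = ⊥-elim (absorb-f h∈ (Star.reverse via-sym path))

    -- A closed `R` above `exchange` that misses `e` would turn, by swapping `f` for `e`, into a
    -- closed set above `B` that misses `f`, against `Generates B`. So `R` contains `e` and with it
    -- all of `B`.
    generates-exchange : B ⊆ E H → Generates B → Generates exchange
    generates-exchange B⊆E gen {R} closed B′⊆R with e ∈? R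
    ... | yes e∈R = gen closed B⊆R
      where
      B⊆R : B ⊆ R
      B⊆R {g} g∈B with g ≟ e
      ... | yes refl = e∈R
      ... | no g≢e   = B′⊆R (p⊆p∪q ⁅ f ⁆ (x∈p∧x≢y⇒x∈p-y g∈B g≢e))
    ... | no e∉R = ⊥-elim (f∉R′ (gen (closed-exchange closed (B⊆E e∈B) (B′⊆R f∈exchange) e∉R) B⊆R′ f∈E))
      where
      f∉R′ : f ∉ (R - f) ∪ ⁅ e ⁆
      f∉R′ f∈ with x∈p∪q⁻ (R - f) ⁅ e ⁆ f∈
      ... | inj₁ f∈R-f = x∈p─q⇒x∉q R ⁅ f ⁆ f∈R-f (x∈⁅x⁆ f)
      ... | inj₂ f∈e   = e≢f (sym (x∈⁅y⁆⇒x≡y e f∈e))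
      B⊆R′ : B ⊆ (R - f) ∪ ⁅ e ⁆
      B⊆R′ {g} g∈B with g ≟ e
      ... | yes refl = q⊆p∪q (R - f) ⁅ e ⁆ (x∈⁅x⁆ e)
      ... | no g≢e   = p⊆p∪q ⁅ e ⁆ (x∈p∧x≢y⇒x∈p-y (B′⊆R (p⊆p∪q ⁅ f ⁆ (x∈p∧x≢y⇒x∈p-y g∈B g≢e))) λ { refl → f∉B g∈B })

    base-exchange : B ⊆ E H → ConnOff B → Generates B → PeripheralBase 2 H exchange
    base-exchange B⊆E conn gen = peripheral-base H (exchange⊆E B⊆E) (connOff-exchange B⊆E conn) (generates-exchange B⊆E gen)

-- Bases of G - r

nonIncident⁺ : ∀ {n m} (ends : Ends n m) {r g} → proj₁ (ends g) ≢ r → proj₂ (ends g) ≢ r → g ∈ nonIncident ends r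
nonIncident⁺ ends {r} {g} ≢₁ ≢₂ = ∈-tabulate⁺
  (cong₂ (λ a b → not (a ∨ b)) (dec-false (proj₁ (ends g) ≟ r) ≢₁) (dec-false (proj₂ (ends g) ≟ r) ≢₂))

module VertexDeleted {n m : ℕ} {ends : Ends n m} (G : Graph ends) (connected : EdgeConnected 3 G) (cubic : Cubic G)
                     (r : Fin n) (r∈ : r ∈ V G) where

  H : Graph ends
  H = deleteVertex G r

  VH⊆VG : V H ⊆ V G
  VH⊆VG = p─q⊆p (V G) ⁅ r ⁆

  EH⊆EG : E H ⊆ E G
  EH⊆EG = p∩q⊆p (E G) (nonIncident ends r)

  VH⇒≢r : ∀ {x} → x ∈ V H → x ≢ r
  VH⇒≢r x∈ refl = x∈p─q⇒x∉q (V G) ⁅ r ⁆ x∈ (x∈⁅x⁆ r)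

  ≢r⇒VH : ∀ {x} → x ∈ V G → x ≢ r → x ∈ V H
  ≢r⇒VH = x∈p∧x≢y⇒x∈p-y

  open Ears G connected cubic

  induced : ∀ {g p q} → g ∈ E G → Joins ends g p q → p ∈ V H → q ∈ V H → g ∈ E H
  induced {g} g∈ j p∈ q∈ with joins-pair j (joins-ends g)
  ... | inj₁ (refl , refl) = x∈p∩q⁺ (g∈ , nonIncident⁺ ends (VH⇒≢r p∈) (VH⇒≢r q∈))
  ... | inj₂ (refl , refl) = x∈p∩q⁺ (g∈ , nonIncident⁺ ends (VH⇒≢r q∈) (VH⇒≢r p∈))

  open Growth G connected cubic H (VH⊆VG , EH⊆EG) induced
  open Exchange H

  ThreeBases : Set
  ThreeBases = ∃[ B₁ ] ∃[ B₂ ] ∃[ B₃ ]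
    PeripheralBase 2 H B₁ × PeripheralBase 2 H B₂ × PeripheralBase 2 H B₃ ×
    (2 < ∣ V G ∣ → B₁ ≢ B₂ × B₁ ≢ B₃ × B₂ ≢ B₃)

  incident-unique : ∀ {v} → v ∈ V G → ∀ {gs} → Unique gs → All (λ g → ∃[ x ] g ∈ E G × Joins ends g v x) gs → length gs ≤ 3
  incident-unique {v} v∈ {gs} uniq incident =
    ≤-trans (length≤ incident) (≤-trans (sum-unique (weight ⟪ v ⟫ full) uniq) (≤-reflexive (degree≡3 v∈)))
    where
    length≤ : ∀ {gs} → All (λ g → ∃[ x ] g ∈ E G × Joins ends g v x) gs →
              length gs ≤ sumᴸ (map (weight ⟪ v ⟫ full) gs)
    length≤ []                  = z≤n
    length≤ ((_ , g∈ , j) ∷ is) = +-mono-≤ (edge-weight g∈ j ⟪⟫⁺ full-∋) (length≤ is)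

  -- The case of two vertices joined by three parallel edges: deleting `r` leaves a vertex without
  -- edges, whose only base is the empty set. It is listed three times, and `∣V∣≤2` makes the claim
  -- of distinctness vacuous.
  module Small (z : Fin n) (r-or-z : ∀ {y} → y ∈ V G → y ≡ r ⊎ y ≡ z) where

    VH⇒z : ∀ {y} → y ∈ V H → y ≡ z
    VH⇒z y∈ = [ (λ y≡r → ⊥-elim (VH⇒≢r y∈ y≡r)) , id ]′ (r-or-z (VH⊆VG y∈))

    -- An edge of `H` would be a loop at `z`, in addition to the three edges from `z` to `r`.
    no-edges : ∀ {g} → g ∈ E H → ⊥
    no-edges {g} g∈ = 1+n≰n (begin
      4                                        ≤⟨ +-mono-≤ (edge⇒link {⟪ z ⟫} {⟪ z ⟫} (EH⊆EG g∈) (joins-ends g) z₁ z₂)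
                                                   (3≤cut connected ⟪ z ⟫ z∈ r∈ ⟪⟫⁺ (∉⟪⟫ (≢-sym z≢r))) ⟩
      link ⟪ z ⟫ ⟪ z ⟫ + link ⟪ z ⟫ (∁ ⟪ z ⟫)  ≡⟨ sym (link-splitʳ ⟪ z ⟫ (λ _ → full-∋)) ⟩
      link ⟪ z ⟫ full                          ≡⟨ degree≡3 z∈ ⟩
      3                                        ∎)
      where
      open ≤-Reasoning
      u∈ = proj₁ (ends∈V H g∈)
      v∈ = proj₂ (ends∈V H g∈)
      z∈H : z ∈ V H
      z∈H = subst (_∈ V H) (VH⇒z u∈) u∈
      z∈ : z ∈ V G
      z∈ = VH⊆VG z∈H
      z≢r : z ≢ r
      z≢r = VH⇒≢r z∈H
      z₁ : ⟪ z ⟫ ∋ proj₁ (ends g)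
      z₁ = subst (⟪ z ⟫ ∋_) (sym (VH⇒z u∈)) ⟪⟫⁺
      z₂ : ⟪ z ⟫ ∋ proj₂ (ends g)
      z₂ = subst (⟪ z ⟫ ∋_) (sym (VH⇒z v∈)) ⟪⟫⁺

    empty-base : PeripheralBase 2 H ∅
    empty-base = peripheral-base H (⊥-elim ∘ ∉⊥)
      (λ U x∈ y∈ Ux Uy → ⊥-elim (≢-by Ux Uy (trans (VH⇒z x∈) (sym (VH⇒z y∈)))))
      (λ _ _ g∈ → ⊥-elim (no-edges g∈))

    ∣V∣≤2 : ∣ V G ∣ ≤ 2
    ∣V∣≤2 = begin
      ∣ V G ∣                  ≤⟨ p⊆q⇒∣p∣≤∣q∣ V⊆ ⟩
      ∣ ⁅ r ⁆ ∪ ⁅ z ⁆ ∣        ≤⟨ ∣p∪q∣≤∣p∣+∣q∣ ⁅ r ⁆ ⁅ z ⁆ ⟩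
      ∣ ⁅ r ⁆ ∣ + ∣ ⁅ z ⁆ ∣    ≡⟨ cong₂ _+_ (∣⁅x⁆∣≡1 r) (∣⁅x⁆∣≡1 z) ⟩
      2                        ∎
      where
      open ≤-Reasoning
      V⊆ : V G ⊆ ⁅ r ⁆ ∪ ⁅ z ⁆
      V⊆ y∈ with r-or-z y∈
      ... | inj₁ refl = p⊆p∪q ⁅ z ⁆ (x∈⁅x⁆ r)
      ... | inj₂ refl = q⊆p∪q ⁅ r ⁆ ⁅ z ⁆ (x∈⁅x⁆ z)

    three-bases : ThreeBases
    three-bases = ∅ , ∅ , ∅ , empty-base , empty-base , empty-base , λ 2< → ⊥-elim (<⇒≱ 2< ∣V∣≤2)

  Y : VSet n
  Y = ⌊ V H ⌋

  Y⊆H : ∀ {y} → Y ∋ y → y ∈ V H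
  Y⊆H = ⌊⌋⁻

  ¬Yr : Y ∌ r
  ¬Yr = ⌊⌋-∌⁺ λ r∈H → VH⇒≢r r∈H refl

  Y⁺ : ∀ {y} → y ∈ V G → y ≢ r → Y ∋ y
  Y⁺ y∈ y≢r = ⌊⌋⁺ (≢r⇒VH y∈ y≢r)

  ¬Y⇒r : ∀ {y} → y ∈ V G → Y ∌ y → y ≡ r
  ¬Y⇒r {y} y∈ ¬Yy with y ≟ r
  ... | yes y≡r = y≡r
  ... | no  y≢r = ⊥-elim (∋∌⇒⊥ (Y⁺ y∈ y≢r) ¬Yy)

  -- If no edge within `Y` crossed `U`, each of the two sides of `Y` would send its whole cut to
  -- `r`, at least three edges each, while `r` has degree 3.
  connY : ConnG Y
  connY U {x} {y} Yx Yy Ux Uy with 1 ≤? link (Y ∩ᵛ U) (Y ∖ U)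
  ... | yes 1≤ with link⇒edge 1≤
  ...   | g , g∈ , p , q , j , YUp , YUq = g , p , q , g∈ , j , proj₁ (∩⁻ YUp) , ∖⊑ YUq , proj₂ (∩⁻ YUp) , ∖-∌ YUq
  connY U {x} {y} Yx Yy Ux Uy | no ¬1≤ = ⊥-elim (<⇒≱ (s≤s (s≤s (s≤s (s≤s z≤n)))) (begin
      6                                         ≤⟨ +-mono-≤ (all-to-r U Yx Yy Ux Uy none)
                                                     (all-to-r (∁ U) Yy Yx (∁⁺ Uy) (∁-∌⁺ Ux) none-∁) ⟩
      link ⟪ r ⟫ (Y ∩ᵛ U) + link ⟪ r ⟫ (Y ∩ᵛ ∁ U) ≤⟨ +-monoʳ-≤ (link ⟪ r ⟫ (Y ∩ᵛ U)) (link-mono id rest⊑) ⟩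
      link ⟪ r ⟫ (Y ∩ᵛ U) + link ⟪ r ⟫ (∁ (Y ∩ᵛ U)) ≡⟨ sym (link-splitʳ ⟪ r ⟫ (λ _ → full-∋)) ⟩
      link ⟪ r ⟫ full                           ≡⟨ degree≡3 r∈ ⟩
      3                                         ∎))
    where
    open ≤-Reasoning
    rest⊑ : Y ∩ᵛ ∁ U ⊑ ∁ (Y ∩ᵛ U)
    rest⊑ x∈ = ∁⁺ (∌-⊑ (proj₂ ∘ ∩⁻) (∁⁻ (proj₂ (∩⁻ x∈))))
    none : ∀ {g p q} → g ∈ E G → Joins ends g p q → Y ∋ p → Y ∋ q → U ∋ p → U ∌ q → ⊥
    none g∈ j Yp Yq Up Uq = ¬1≤ (edge⇒link g∈ j (∩⁺ Yp Up) (∖⁺ Yq Uq))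
    none-∁ : ∀ {g p q} → g ∈ E G → Joins ends g p q → Y ∋ p → Y ∋ q → ∁ U ∋ p → ∁ U ∌ q → ⊥
    none-∁ g∈ j Yp Yq Up Uq = none g∈ (joins-sym j) Yq Yp (∁-∌⁻ Uq) (∁⁻ Up)
    all-to-r : ∀ U {x y} → Y ∋ x → Y ∋ y → U ∋ x → U ∌ y →
      (∀ {g p q} → g ∈ E G → Joins ends g p q → Y ∋ p → Y ∋ q → U ∋ p → U ∌ q → ⊥) → 3 ≤ link ⟪ r ⟫ (Y ∩ᵛ U)
    all-to-r U Yx Yy Ux Uy none = begin
      3                                          ≤⟨ 3≤cut connected A (VH⊆VG (Y⊆H Yx)) (VH⊆VG (Y⊆H Yy)) (∩⁺ Yx Ux) (∌-⊑ (proj₂ ∘ ∩⁻) Uy) ⟩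
      link A (∁ A)                               ≡⟨ link-splitʳ A (λ x∈ → subst (∁ A ∋_) (sym (⟪⟫⁻ x∈)) (∁⁺ (∌-⊑ (proj₁ ∘ ∩⁻) ¬Yr))) ⟩
      link A ⟪ r ⟫ + link A (∁ A ∖ ⟪ r ⟫)        ≡⟨ cong₂ _+_ (link-sym A ⟪ r ⟫) (no-edge⇒link≡0 no-other) ⟩
      link ⟪ r ⟫ A + 0                           ≡⟨ +-identityʳ _ ⟩
      link ⟪ r ⟫ A                               ∎
      where
      A : VSet n
      A = Y ∩ᵛ U
      no-other : ∀ {g p q} → g ∈ E G → Joins ends g p q → A ∋ p → ∁ A ∖ ⟪ r ⟫ ∋ q → ⊥
      no-other {q = q} g∈ j Ap q∈ = none g∈ j (proj₁ (∩⁻ Ap)) Yq (proj₂ (∩⁻ Ap))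
        (¬∋⇒∌ λ Uq → ∋∌⇒⊥ (∩⁺ Yq Uq) (∁⁻ (∖⊑ q∈)))
        where
        Yq : Y ∋ q
        Yq = Y⁺ (proj₂ (joins∈V G g∈ j)) λ { refl → ∋∌⇒⊥ ⟪⟫⁺ (∖-∌ q∈) }

  module FirstEar {c : Fin m} {z : Fin n} (c∈ : c ∈ E G) (c-joins : Joins ends c z r) (Yz : Y ∋ z)
                  (W : VSet n) (W⊑Y : W ⊑ Y) (z∉W : W ∌ z) (conn-W : ConnG W) (conn-K : ConnG (Y ∖ W))
                  (attached : ∀ {v} → W ∋ v → 1 ≤ link ⟪ v ⟫ (Y ∖ W))
                  {g₁ g₂ : Fin m} {a b : Fin n} (g₁≢g₂ : g₁ ≢ g₂) (g₁∈ : g₁ ∈ E G) (g₂∈ : g₂ ∈ E G)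
                  (j₁ : Joins ends g₁ a r) (j₂ : Joins ends g₂ b r) (Wa : W ∋ a) (Wb : W ∋ b) where

    K : VSet n
    K = Y ∖ W

    W⊆G : ∀ {x} → W ∋ x → x ∈ V G
    W⊆G = VH⊆VG ∘ Y⊆H ∘ W⊑Y

    to-W≢to-K : ∀ {g h p q} → W ∋ p → W ∌ q → Joins ends g p r → Joins ends h q r → g ≢ h
    to-W≢to-K Wp ¬Wq j k refl with joins-pair j k
    ... | inj₁ (refl , _)    = ∋∌⇒⊥ Wp ¬Wq
    ... | inj₂ (refl , refl) = ∋∌⇒⊥ Wp ¬Wq

    -- The degree of `r` is exhausted by `g₁`, `g₂` and `c`, the first two of which end in `W`. This
    -- gives `boundary` after the first ear.
    only-c : ∀ {g q} → g ∈ E G → Joins ends g q r → K ∋ q → g ≡ c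
    only-c {g} g∈ j Kq with g ≟ c
    ... | yes g≡c = g≡c
    ... | no  g≢c = ⊥-elim (1+n≰n (incident-unique r∈
      ((g₁≢g₂ ∷ to-W≢to-K Wa (∖-∌ Kq) j₁ j ∷ to-W≢to-K Wa z∉W j₁ c-joins ∷ []) ∷
       (to-W≢to-K Wb (∖-∌ Kq) j₂ j ∷ to-W≢to-K Wb z∉W j₂ c-joins ∷ []) ∷ (g≢c ∷ []) ∷ [] ∷ [])
      ((_ , g₁∈ , joins-sym j₁) ∷ (_ , g₂∈ , joins-sym j₂) ∷ (_ , g∈ , joins-sym j) ∷ (_ , c∈ , joins-sym c-joins) ∷ [])))

    connOff-∅ : ConnOff ∅
    connOff-∅ U x∈ y∈ Ux Uy with connY U (⌊⌋⁺ x∈) (⌊⌋⁺ y∈) Ux Uy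
    ... | g , p , q , g∈ , j , Yp , Yq , Up , Uq =
      g , p , q , (induced g∈ j (Y⊆H Yp) (Y⊆H Yq) , ∉⊥) , j , Y⊆H Yp , Y⊆H Yq , Up , Uq

    -- The growth starts only after the first ear: with all of G - r as `Y`, `boundary` would fail
    -- at `g₁` and `g₂`. The vertices of `H` outside `K` are those of `W`, which is connected and
    -- therefore spanned by its own edges.
    first : State c∈ c-joins K (inside W)
    first = record
      { Yz = ∖⁺ Yz z∉W ; ¬Yx = ∌-⊑ ∖⊑ ¬Yr ; Y⊆H = Y⊆H ∘ ∖⊑ ; connY = conn-K
      ; boundary = boundary′
      ; B⊆E = inside⊆E c∈ c-joins (Y⊆H ∘ W⊑Y)
      ; B-outside = λ g∈ j Kp _ → ∋∌⇒⊥ (proj₁ (proj₂ (inside⁻ g∈) j)) (∖-∌ Kp)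
      ; connOff = subst ConnOff (∪-identityˡ (inside W))
          (connOff-attached Y⊆H W⊑Y (λ g∈ _ _ _ → ∉⊥ g∈) conn-K attached connOff-∅)
      ; spans = λ _ W⊆R (u∈ , ¬Ku) (v∈ , ¬Kv) →
          inside-spans conn-W W⊆R (∖-∌⁻ (⌊⌋⁺ u∈) ¬Ku) (∖-∌⁻ (⌊⌋⁺ v∈) ¬Kv) }
      where
      boundary′ : ∀ {g p q} → g ∈ E G → g ≢ c → Joins ends g p q → K ∌ p → K ∋ q → g ∈ E H
      boundary′ {p = p} g∈ g≢c j ¬Kp Kq with p ≟ r
      ... | yes refl = ⊥-elim (g≢c (only-c g∈ (joins-sym j) Kq))
      ... | no p≢r   = induced g∈ j (≢r⇒VH (proj₁ (joins∈V G g∈ j)) p≢r) (Y⊆H (∖⊑ Kq))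

    -- Two parallel edges between `a` and `r` would leave one further edge at each, so the cut
    -- around the pair would have at most two edges; `z` lies on its other side.
    a≢b : a ≢ b
    a≢b refl = 1+n≰n (begin
      3                                          ≤⟨ 3≤cut connected P (W⊆G Wa) (VH⊆VG (Y⊆H Yz)) (∪⁺ˡ ⟪⟫⁺)
                                                      (∪-∌⁺ (∉⟪⟫ (≢-sym (≢-by Wa z∉W))) (∉⟪⟫ (≢-by Yz ¬Yr))) ⟩
      link P (∁ P)                               ≡⟨ link-splitˡ (∁ P) ∪⁺ˡ ⟩
      link ⟪ a ⟫ (∁ P) + link (P ∖ ⟪ a ⟫) (∁ P)  ≤⟨ +-monoʳ-≤ (link ⟪ a ⟫ (∁ P)) (link-mono rest⊑ id) ⟩
      link ⟪ a ⟫ (∁ P) + link ⟪ r ⟫ (∁ P)        ≤⟨ +-mono-≤ (one-out (W⊆G Wa) j₁ j₂ (∪⁺ʳ ⟪⟫⁺))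
                                                             (one-out r∈ (joins-sym j₁) (joins-sym j₂) (∪⁺ˡ ⟪⟫⁺)) ⟩
      2                                          ∎)
      where
      open ≤-Reasoning
      P : VSet n
      P = ⟪ a ⟫ ∪ᵛ ⟪ r ⟫
      rest⊑ : P ∖ ⟪ a ⟫ ⊑ ⟪ r ⟫
      rest⊑ x∈ = [ (λ xa → ⊥-elim (∋∌⇒⊥ xa (∖-∌ x∈))) , id ]′ (∪⁻ (∖⊑ x∈))
      one-out : ∀ {v w} → v ∈ V G → Joins ends g₁ v w → Joins ends g₂ v w → P ∋ w → link ⟪ v ⟫ (∁ P) ≤ 1
      one-out {v} v∈ k₁ k₂ Pw = +-cancelˡ-≤ 2 _ 1 (begin
        2 + link ⟪ v ⟫ (∁ P)                 ≤⟨ +-monoˡ-≤ (link ⟪ v ⟫ (∁ P)) (≤-trans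
                                                  (+-mono-≤ (edge-weight g₁∈ k₁ ⟪⟫⁺ Pw) (+-mono-≤ (edge-weight g₂∈ k₂ ⟪⟫⁺ Pw) (z≤n {0})))
                                                  (sum-unique (weight ⟪ v ⟫ P) ((g₁≢g₂ ∷ []) ∷ [] ∷ []))) ⟩
        link ⟪ v ⟫ P + link ⟪ v ⟫ (∁ P)      ≡⟨ sym (link-splitʳ ⟪ v ⟫ (λ _ → full-∋)) ⟩
        link ⟪ v ⟫ full                      ≡⟨ degree≡3 v∈ ⟩
        3                                    ∎)

    not-at-r : ∀ {g x y} → g ∈ E H → Joins ends g x y → ∀ {h v} → Joins ends h v r → g ≢ h
    not-at-r g∈ j k refl = VH⇒≢r (proj₂ (joins∈V H g∈ k)) refl

    module _ {B : Subset m} (W⊆B : inside W ⊆ B) (origin : ∀ {g} → g ∈ B → g ∈ inside W ⊎ g ∈ inside K) where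

      -- The three edges at `v` lead one each to `r`, to `W`, which is connected and has another
      -- vertex, and to `K`, since `v` is attached. Of the two that `H` keeps, the former is in `B`
      -- as an edge inside `W`, and by `origin` the latter is not.
      exchangeable : ∀ {g v w} → g ∈ E G → Joins ends g v r → W ∋ v → W ∋ w → v ≢ w →
                     Σ (Exchangeable B v) λ ex → K ∋ Exchangeable.k ex
      exchangeable {g} {v} {w} g∈ j Wv Ww v≢w
        with conn-W ⟪ v ⟫ Wv Ww ⟪⟫⁺ (∉⟪⟫ (≢-sym v≢w)) | link⇒edge (attached Wv)
      ... | e , p , q , e∈ , je , Wp , Wq , vp , ¬vq | f , f∈ , p′ , k , jf , vp′ , Kk with ⟪⟫⁻ vp | ⟪⟫⁻ vp′
      ... | refl | refl = record
        { e-joins = je ; f-joins = jf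
        ; w≢a = ≢-sym (≢-by ⟪⟫⁺ ¬vq) ; k≢a = ≢-sym (≢-by Wv (∖-∌ Kk))
        ; e∈B = W⊆B (inside⁺ e∈ je Wp Wq) ; f∈E = f∈H ; f∉B = f∉B
        ; only = only } , Kk
        where
        e∈H : e ∈ E H
        e∈H = induced e∈ je (Y⊆H (W⊑Y Wp)) (Y⊆H (W⊑Y Wq))
        f∈H : f ∈ E H
        f∈H = induced f∈ jf (Y⊆H (W⊑Y Wv)) (Y⊆H (∖⊑ Kk))
        f∉B : f ∉ B
        f∉B f∈B = [ (λ f∈W → ∋∌⇒⊥ (proj₂ (proj₂ (inside⁻ f∈W) jf)) (∖-∌ Kk))
                  , (λ f∈K → ∋∌⇒⊥ Wv (∖-∌ (proj₁ (proj₂ (inside⁻ f∈K) jf)))) ]′ (origin f∈B)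
        distinct : e ≢ f
        distinct refl = f∉B (W⊆B (inside⁺ e∈ je Wp Wq))
        only : ∀ {h x} → h ∈ E H → Joins ends h v x → h ≡ e ⊎ h ≡ f
        only {h} h∈ jh with h ≟ e | h ≟ f
        ... | yes h≡e | _       = inj₁ h≡e
        ... | no _    | yes h≡f = inj₂ h≡f
        ... | no h≢e  | no h≢f  = ⊥-elim (1+n≰n (incident-unique (W⊆G Wv)
          ((h≢e ∷ h≢f ∷ not-at-r h∈ jh j ∷ []) ∷ (distinct ∷ not-at-r e∈H je j ∷ []) ∷ (not-at-r f∈H jf j ∷ []) ∷ [] ∷ [])
          ((_ , EH⊆EG h∈ , jh) ∷ (_ , e∈ , je) ∷ (_ , f∈ , jf) ∷ (_ , g∈ , j) ∷ [])))

    -- The bases are told apart by the new edges into `K`: neither of these is in `B`, and they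
    -- differ because their ends in `W` are `a` and `b`.
    bases : Completion c∈ c-joins K (inside W) → ThreeBases
    bases (B , W⊆B , B⊆E , origin , conn , gen)
      with exchangeable W⊆B origin g₁∈ j₁ Wa Wb a≢b | exchangeable W⊆B origin g₂∈ j₂ Wb Wa (≢-sym a≢b)
    ... | exa , Ka | exb , Kb =
      B , exchange exa , exchange exb ,
      peripheral-base H B⊆E conn gen , base-exchange exa B⊆E conn gen , base-exchange exb B⊆E conn gen ,
      λ _ → (λ eq → f∉B exa (subst (f exa ∈_) (sym eq) (f∈exchange exa)))
          , (λ eq → f∉B exb (subst (f exb ∈_) (sym eq) (f∈exchange exb)))
          , (λ eq → [ f∉B exa ∘ proj₁ , fa≢fb ]′ (exchange⁻ exb (subst (f exa ∈_) eq (f∈exchange exa))))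
      where
      open Exchangeable
      fa≢fb : f exa ≢ f exb
      fa≢fb eq with joins-pair (f-joins exa) (subst (λ h → Joins ends h b (k exb)) (sym eq) (f-joins exb))
      ... | inj₁ (a≡b , _)  = a≢b a≡b
      ... | inj₂ (a≡k , _) = ∋∌⇒⊥ Wa (subst (W ∌_) (sym a≡k) (∖-∌ Kb))

    three-bases : ThreeBases
    three-bases = bases (complete c∈ c-joins _ ≤-refl first)

  with-ear : ∀ {c z y} → c ∈ E G → Joins ends c z r → Y ∋ z → Y ∋ y → y ≢ z → ThreeBases
  with-ear {c} {z} c∈ j Yz Yy y≢z = from-ear (R.attached-ear Yy y≢z)
    where
    module R = Region Y (VH⊆VG ∘ Y⊆H) z Yz connY (edge⇒link c∈ j ⟪⟫⁺ (∁⁺ ¬Yr))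
    at-r : ∀ {g p q} → g ∈ E G → Joins ends g p q → ∁ Y ∋ q → Joins ends g p r
    at-r {g} {p} g∈ k ∁q = subst (Joins ends g p) (¬Y⇒r (proj₂ (joins∈V G g∈ k)) (∁⁻ ∁q)) k
    from-ear : ∃ R.Attached → ThreeBases
    from-ear (ear , attached) with link⇒two-edges {R.Ear.W ear} {∁ Y} (λ Wx ∁x → ∋∌⇒⊥ (R.Ear.W⊑Y ear Wx) (∁⁻ ∁x)) (R.Ear.feet ear)
    ... | g₁ , g₂ , g₁≢g₂ , (g₁∈ , a , q₁ , j₁ , Wa , ∁q₁) , (g₂∈ , b , q₂ , j₂ , Wb , ∁q₂) =
      FirstEar.three-bases c∈ j Yz (R.Ear.W ear) (R.Ear.W⊑Y ear) (R.Ear.z∉W ear) (R.Ear.conn-W ear) (R.Ear.conn-K ear)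
        attached g₁≢g₂ g₁∈ g₂∈ (at-r g₁∈ j₁ ∁q₁) (at-r g₂∈ j₂ ∁q₂) Wa Wb

  neighbour : ∀ {y} → y ∈ V G → y ≢ r → ∃[ c ] ∃[ z ] c ∈ E G × Joins ends c z r × Y ∋ z
  neighbour y∈ y≢r with link⇒edge {⟪ r ⟫} {∁ ⟪ r ⟫} (≤-trans (s≤s z≤n) (3≤cut connected ⟪ r ⟫ r∈ y∈ ⟪⟫⁺ (∉⟪⟫ y≢r)))
  ... | c , c∈ , p , z , j , rp , ¬rz with ⟪⟫⁻ rp
  ...   | refl = c , z , c∈ , joins-sym j , Y⁺ (proj₂ (joins∈V G c∈ j)) λ { refl → ∋∌⇒⊥ ⟪⟫⁺ (∁⁻ ¬rz) }

  three-bases : ThreeBases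
  three-bases with any? (λ y → (y ∈? V G) ×-dec ¬? (y ≟ r))
  -- With `r` in the role of `z`, the small case covers a graph on the single vertex `r`.
  ... | no none = Small.three-bases r λ {y} y∈ → inj₁ (≡r y y∈)
    where
    ≡r : ∀ y → y ∈ V G → y ≡ r
    ≡r y y∈ with y ≟ r
    ... | yes y≡r = y≡r
    ... | no  y≢r = ⊥-elim (none (y , y∈ , y≢r))
  ... | yes (y , y∈ , y≢r) with neighbour y∈ y≢r
  ...   | c , z , c∈ , j , Yz with any? (λ y → (Y ∋? y) ×-dec ¬? (y ≟ z))
  ...     | yes (y′ , Yy′ , y′≢z) = with-ear c∈ j Yz Yy′ y′≢z
  ...     | no none = Small.three-bases z λ {y} y∈ → r-or-z y y∈
    where
    r-or-z : ∀ y → y ∈ V G → y ≡ r ⊎ y ≡ z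
    r-or-z y y∈ with y ≟ r | y ≟ z
    ... | yes y≡r | _       = inj₁ y≡r
    ... | no _    | yes y≡z = inj₂ y≡z
    ... | no y≢r  | no y≢z  = ⊥-elim (none (y , Y⁺ y∈ y≢r , y≢z))

lemma7p2 : ∀ {n m : ℕ} {ends : Ends n m} (G : Graph ends) →
    EdgeConnected 3 G → Cubic G →
    (∀ (C : Graph ends) → C ⊆ᴳ G → IsCycle C → Peripheral G (E C) →
    ∃[ B ] PeripheralBase 2 G B × E C ⊆ B)
    ×
    (∀ r → r ∈ V G →
    ∃[ B₁ ] ∃[ B₂ ] ∃[ B₃ ]
    PeripheralBase 2 (deleteVertex G r) B₁ ×
    PeripheralBase 2 (deleteVertex G r) B₂ ×
    PeripheralBase 2 (deleteVertex G r) B₃ ×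
    (2 < ∣ V G ∣ → B₁ ≢ B₂ × B₁ ≢ B₃ × B₂ ≢ B₃))
lemma7p2 G connected cubic =
  (λ C C⊆G cyc peripheral → PeripheralCycle.peripheral-base-⊇C G connected cubic C C⊆G cyc peripheral) ,
  (λ r r∈ → VertexDeleted.three-bases G connected cubic r r∈)
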